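{- For an integer $k\geq 1$ and an integer $n \geq 0$, let $a_k(n)$ denote the number of partitions of $n$ in which each even part comes in only one color while each odd part may be colored with one of $k$ colors; equivalently, $$\sum_{n=0}^\infty a_k(n)q^n = \frac{(q^2;q^2)_\infty^{k-1}}{(q;q)_\infty^{k}}.$$ Then for all $n\geq 0$, \begin{align*} a_{1}(7n+5) & \equiv 0 \pmod{7},\\ a_{3}(7n+2) & \equiv 0 \pmod{7},\\ a_{4}(7n+4) & \equiv 0 \pmod{7},\\ a_{5}(7n+6) & \equiv 0 \pmod{7},\\ a_{7}(7n+3) & \equiv 0 \pmod{7}. \end{align*}
   Context: Here $(A;q)_\infty = \prod_{i\geq 0}(1-Aq^i)$ is the $q$-Pochhammer symbol. In a $k$-colored partition, parts of the same size but different colors are distinguished, and partitions are unordered multisets of colored parts (e.g. $a_3(3)=16$). -}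

module Defs where

open import Data.Nat using (ℕ; zero; suc; _+_; _*_; _∸_; _≤?_)
open import Data.Nat.Base using (_%_)
open import Data.Nat.ListAction using (sum)
open import Data.List using (List; []; _∷_; map; filter; upTo; replicate; concatMap)
open import Data.Bool using (if_then_else_)
open import Relation.Nullary.Decidable using (⌊_⌋)
open import Data.Nat.Properties using (_≟_)

colors : ℕ → ℕ → ℕ
colors k j = if ⌊ j % 2 ≟ 0 ⌋ then 1 else k

partTypes : ℕ → ℕ → List ℕ
partTypes k n = concatMap (λ j → replicate (colors k j) j) (map suc (upTo n))

-- countMultisets ts n = number of multisets of elements of the (positionally
-- distinguished) list of part types ts whose sizes sum to n; i.e. for each
-- type a multiplicity m ≥ 0 is chosen, with total size n.
countMultisets : List ℕ → ℕ → ℕ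
countMultisets [] zero = 1
countMultisets [] (suc n) = 0
countMultisets (t ∷ ts) n =
  sum (map (λ m → countMultisets ts (n ∸ m * t))
           (filter (λ m → m * t ≤? n) (upTo (suc n))))

a : ℕ → ℕ → ℕ
a k n = countMultisets (partTypes k n) n

{-# OPTIONS --safe #-}

-- Write f_i = (q^i; q^i)_∞. As f_1^7 ≡ f_7 (mod 7), the generating function of a_k is, up to a
-- series in q^7, f_2^(k-1) f_1^(7-k), and multiplying by series in q^7 does not affect whether the
-- coefficients in a given residue class of exponents mod 7 vanish. By Jacobi's identity f_1^3 is
-- supported mod 7 on the exponents 0, 1, 3 (mod 7), which settles f_1^6, f_1^3 f_2^3 and f_2^6
-- (k = 1, 4, 7).
--
-- For E = f_1^4 f_2^2 (k = 3) and f_1^2 f_2^4 (k = 5), let φ(q) = Σ q^(n²), ψ(q) = Σ_{n≥0} q^(n(n+1)/2),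
--   G± = φ(±q) f_2^5,   Z± = φ(±q) f_8^5,   V± = φ(±q) f_2^2 f_4 f_8^2,
-- so that G- = f_1^2 f_2^4. The dissections φ(q) = φ(q^4) + 2q ψ(q^8) and
-- φ(-q)^2 = φ(q^2)^2 - 4q ψ(q^4)^2 give, where each term may be multiplied by seventh powers f_i^(±7),
--   G±(q) ~ Z+(q^2) ± 2q V+(q^2),   Z±(q) ~ G+(q^4) ± 2q E(q^8),   V±(q) ~ Z-(q^2) ± 2q V-(q^2),
--   E(q) ~ f_4^3 f_8^3 - 4q f_4^3 f_16^3 + 16q^3 G-(q^8).
-- All shifts are compatible with the classes 6, 3, 6, 2 to be avoided by G, Z, V, E, so the claims
-- descend along q → q^2 → q^4 → ... and it remains to note that the constant term lies in none of these classes.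

module Submission where

open import Algebra.Bundles using (CommutativeRing)
open import Data.Bool using (if_then_else_; true; false)
open import Data.Empty using (⊥-elim)
open import Data.List.Base using (List; []; _∷_; _++_; map; filter; applyUpTo; upTo; replicate; concatMap)
import Data.List.Properties as List
open import Data.List.Relation.Unary.All as All using (All; []; _∷_)
import Data.List.Relation.Unary.All.Properties as All
open import Data.Nat.Base as ℕ using (ℕ; zero; suc; _%_; _≤ᵇ_; _≤_; _<_; z≤n; s≤s)
open import Data.Nat.Divisibility using (_∣_; m%n≡0⇒n∣m)
open import Data.Nat.DivMod using (%-distribˡ-+; %-distribˡ-*; [m+kn]%n≡m%n)
open import Data.Nat.ListAction using (sum)
import Data.Nat.Properties as ℕ
open import Data.Nat.Properties using (_≤?_)
open import Data.Nat.Solver using (module +-*-Solver)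
open import Data.Product using (_×_; _,_; ∃-syntax)
open import Data.Sum as Sum using (_⊎_; inj₁; inj₂; [_,_]′)
open import Data.Unit using (⊤; tt)
open import Function using (_∘_; id)
open import Level using (Level; 0ℓ)
open import Relation.Binary.PropositionalEquality as ≡ using (_≡_)
open import Relation.Nullary using (¬_; yes; no)

-- The triple product and its consequences in a commutative ring with nilpotent q

-- Origin of the classes: give a product of powers f_i^(e_i) the weight w = Σ i e_i. The class to be
-- avoided is always the r with 24 r + w ≡ 0 (mod 7); φ has weight 0, and ψ has weight 3. If q^s P
-- occurs in a dissection of L, then w(P) ≡ w(L) + 24 s (mod 7), and seventh powers leave weights
-- unchanged modulo 7. This is why all shifts are compatible. The obstacle for k = 3 and k = 5 is
-- that, even up to seventh powers, f_1^4 f_2^2 and f_1^2 f_2^4 do not split into two cubes, so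
-- Jacobi's identity does not apply directly. Dissection splits off pairs of cubes, but leaves a
-- remainder of the same family in a higher power of q. Working modulo a power of q makes the
-- descent finite, since q^(2^k) vanishes for large k. It also makes every variable nilpotent:
-- infinite products become finite ones, limits are attained, and quotient formulas are used with
-- their denominators cleared.

module FormalTheta {c ℓ : Level} (R : CommutativeRing c ℓ) where

  open CommutativeRing R
  open import Algebra.Properties.Ring ring using (-‿distribˡ-*; -‿distribʳ-*; -‿involutive)
  open import Algebra.Properties.CommutativeSemiring.Exp commutativeSemiring
  open import Algebra.Properties.Semiring.Mult semiring using () renaming (_×_ to _×′_)
  open import Algebra.Solver.Ring.NaturalCoefficients.Default commutativeSemiring
    using (solve; _:=_; _:+_; _:*_; _:^_; con)
  open import Relation.Binary.Reasoning.Setoid setoid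

  Σ : (ℕ → Carrier) → ℕ → Carrier
  Σ g zero    = 0#
  Σ g (suc n) = g 0 + Σ (g ∘ suc) n

  Σ-cong : ∀ {g h} n → (∀ k → k ℕ.< n → g k ≈ h k) → Σ g n ≈ Σ h n
  Σ-cong zero    e = refl
  Σ-cong (suc n) e = +-cong (e 0 (s≤s z≤n)) (Σ-cong n (λ k k<n → e (suc k) (s≤s k<n)))

  Σ-+ : ∀ g h n → Σ (λ k → g k + h k) n ≈ Σ g n + Σ h n
  Σ-+ g h zero    = sym (+-identityˡ 0#)
  Σ-+ g h (suc n) = trans (+-congˡ (Σ-+ (g ∘ suc) (h ∘ suc) n))
    (solve 4 (λ a b c d → (a :+ b) :+ (c :+ d) := (a :+ c) :+ (b :+ d)) refl (g 0) (h 0) _ _)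

  Σ-*ˡ : ∀ a g n → a * Σ g n ≈ Σ (λ k → a * g k) n
  Σ-*ˡ a g zero    = zeroʳ a
  Σ-*ˡ a g (suc n) = trans (distribˡ a _ _) (+-congˡ (Σ-*ˡ a (g ∘ suc) n))

  Σ-last : ∀ g n → Σ g (suc n) ≈ Σ g n + g n
  Σ-last g zero    = +-comm (g 0) 0#
  Σ-last g (suc n) = trans (+-congˡ (Σ-last (g ∘ suc) n)) (sym (+-assoc _ _ _))

  ^-vanish : ∀ {y N n} → y ^ N ≈ 0# → N ℕ.≤ n → y ^ n ≈ 0#
  ^-vanish {y} {N} {n} y^N≈0 N≤n = begin
    y ^ n                       ≡⟨ ≡.cong (y ^_) (ℕ.m+[n∸m]≡n N≤n) ⟨
    y ^ (N ℕ.+ (n ℕ.∸ N))       ≈⟨ ^-homo-* y N _ ⟩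
    y ^ N * y ^ (n ℕ.∸ N)       ≈⟨ *-congʳ y^N≈0 ⟩
    0# * y ^ (n ℕ.∸ N)          ≈⟨ zeroˡ _ ⟩
    0#                          ∎

  freshman's-dream : 7 ×′ 1# ≈ 0# → ∀ a b → (a + b) ^ 7 ≈ a ^ 7 + b ^ 7
  freshman's-dream 7≈0 a b = begin
    (a + b) ^ 7
      ≈⟨ solve 2 (λ a b → (a :+ b) :^ 7 := (a :^ 7 :+ b :^ 7) :+ seven :* middle a b) refl a b ⟩
    (a ^ 7 + b ^ 7) + (7 ×′ 1#) * _
      ≈⟨ +-congˡ (trans (*-congʳ 7≈0) (zeroˡ _)) ⟩
    (a ^ 7 + b ^ 7) + 0#
      ≈⟨ +-identityʳ _ ⟩
    a ^ 7 + b ^ 7 ∎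
    where
    -- Written as a sum of ones ending in zero, the form to which `7 ×′ 1#` unfolds. The
    -- coefficients 1, 3, 5, 5, 3, 1 of `middle` are the inner binomial coefficients of 7 divided by
    -- 7.
    seven = con 1 :+ (con 1 :+ (con 1 :+ (con 1 :+ (con 1 :+ (con 1 :+ (con 1 :+ con 0))))))
    middle = λ a b → a :^ 6 :* b :+ con 3 :* a :^ 5 :* b :^ 2 :+ con 5 :* a :^ 4 :* b :^ 3
                  :+ con 5 :* a :^ 3 :* b :^ 4 :+ con 3 :* a :^ 2 :* b :^ 5 :+ a :* b :^ 6

  -- Gaussian binomial coefficients and the Jacobi triple product

  module Gauss (Q : Carrier) where

    -- The Gaussian binomial coefficient, defined by its Pascal rule because the quotient of
    -- q-factorials makes no sense in a general ring.
    B : ℕ → ℕ → Carrier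
    B zero    zero    = 1#
    B zero    (suc k) = 0#
    B (suc n) zero    = 1#
    B (suc n) (suc k) = B n k + Q ^ suc k * B n (suc k)

    B-zero : ∀ n → B n 0 ≈ 1#
    B-zero zero    = refl
    B-zero (suc n) = refl

    B-vanish : ∀ n k → n ℕ.< k → B n k ≈ 0#
    B-vanish zero    (suc k) _         = refl
    B-vanish (suc n) (suc k) (s≤s n<k) = begin
      B n k + Q ^ suc k * B n (suc k)  ≈⟨ +-cong (B-vanish n k n<k) (*-congˡ (B-vanish n (suc k) (ℕ.m<n⇒m<1+n n<k))) ⟩
      0# + Q ^ suc k * 0#              ≈⟨ +-identityˡ _ ⟩
      Q ^ suc k * 0#                   ≈⟨ zeroʳ _ ⟩
      0#                               ∎

    -- Pascal's rule moved from the coefficients to the summands. Both `cauchy` and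
    -- `finite-triple-product` are inductions in which one more factor of the product turns X k into
    -- X (k + 1) + Q^k X k.
    pascal-Σ : ∀ n (X : ℕ → Carrier) → Σ (λ k → B (suc n) k * X k) (suc (suc n))
                     ≈ Σ (λ k → B n k * (X (suc k) + Q ^ k * X k)) (suc n)
    pascal-Σ n X = begin
      1# * X 0 + Σ (λ k → B (suc n) (suc k) * X (suc k)) (suc n)
        ≈⟨ +-cong head (trans (Σ-cong (suc n) (λ k _ → distribʳ (X (suc k)) (B n k) (Q ^ suc k * B n (suc k)))) (Σ-+ Z (Y ∘ suc) (suc n))) ⟩
      Y 0 + (Σ Z (suc n) + Σ (Y ∘ suc) (suc n))
        ≈⟨ solve 3 (λ a b c → a :+ (b :+ c) := b :+ (a :+ c)) refl (Y 0) _ _ ⟩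
      Σ Z (suc n) + Σ Y (suc (suc n))
        ≈⟨ +-congˡ (Σ-last Y (suc n)) ⟩
      Σ Z (suc n) + (Σ Y (suc n) + Y (suc n))
        ≈⟨ +-congˡ (trans (+-congˡ Y-last) (+-identityʳ _)) ⟩
      Σ Z (suc n) + Σ Y (suc n)
        ≈⟨ Σ-+ Z Y (suc n) ⟨
      Σ (λ k → Z k + Y k) (suc n)
        ≈⟨ Σ-cong (suc n) (λ k _ → solve 4 (λ b x' q x → b :* x' :+ (q :* b) :* x := b :* (x' :+ q :* x)) refl (B n k) (X (suc k)) (Q ^ k) (X k)) ⟩
      Σ (λ k → B n k * (X (suc k) + Q ^ k * X k)) (suc n) ∎
      where
      Y Z : ℕ → Carrier
      Y k = (Q ^ k * B n k) * X k
      Z k = B n k * X (suc k)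
      head : 1# * X 0 ≈ Y 0
      head = *-congʳ (sym (trans (*-identityˡ _) (B-zero n)))
      Y-last : Y (suc n) ≈ 0#
      Y-last = trans (*-congʳ (trans (*-congˡ (B-vanish n (suc n) (ℕ.n<1+n n))) (zeroʳ _))) (zeroˡ _)

    P : Carrier → ℕ → Carrier
    P u zero    = 1#
    P u (suc n) = P u n * (1# + u * Q ^ n)

    P-first : ∀ u n → P u (suc n) ≈ (1# + u) * P (u * Q) n
    P-first u zero    = solve 1 (λ u → con 1 :* (con 1 :+ u :* con 1) := (con 1 :+ u) :* con 1) refl u
    P-first u (suc n) = trans (*-congʳ (P-first u n))
      (solve 4 (λ u p q r → ((con 1 :+ u) :* p) :* (con 1 :+ u :* (q :* r)) := (con 1 :+ u) :* (p :* (con 1 :+ (u :* q) :* r))) refl u (P (u * Q) n) Q (Q ^ n))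

    P-stable : ∀ u {N n} → Q ^ N ≈ 0# → N ℕ.≤ n → P u n ≈ P u N
    P-stable u {N} {n} Q^N≈0 N≤n =
      trans (reflexive (≡.cong (P u) (≡.sym (ℕ.m∸n+n≡m N≤n)))) (go (n ℕ.∸ N))
      where
      go : ∀ m → P u (m ℕ.+ N) ≈ P u N
      go zero    = refl
      go (suc m) = begin
        P u (m ℕ.+ N) * (1# + u * Q ^ (m ℕ.+ N))  ≈⟨ *-cong (go m) (+-congˡ (*-congˡ (^-vanish Q^N≈0 (ℕ.m≤n+m N m)))) ⟩
        P u N * (1# + u * 0#)                     ≈⟨ *-congˡ (trans (+-congˡ (zeroʳ u)) (+-identityʳ 1#)) ⟩
        P u N * 1#                                ≈⟨ *-identityʳ _ ⟩
        P u N                                     ∎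

    -- This is u^k Q^(k(k-1)/2), one half of a theta series.
    p : Carrier → ℕ → Carrier
    p u zero    = 1#
    p u (suc k) = p u k * (u * Q ^ k)

    p-vanish : ∀ u {N k} → Q ^ N ≈ 0# → N ℕ.< k → p u k ≈ 0#
    p-vanish u {k = suc k} Q^N≈0 (s≤s N≤k) =
      trans (*-congˡ (trans (*-congˡ (^-vanish Q^N≈0 N≤k)) (zeroʳ u))) (zeroʳ _)

    p-scale : ∀ u z k → p (u * z) k ≈ p u k * z ^ k
    p-scale u z zero    = sym (*-identityʳ 1#)
    p-scale u z (suc k) = trans (*-congʳ (p-scale u z k))
      (solve 5 (λ p s u z r → (p :* s) :* ((u :* z) :* r) := (p :* (u :* r)) :* (z :* s)) refl (p u k) (z ^ k) u z (Q ^ k))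

    -- The q-binomial theorem. The induction splits off the first factor of the product: the
    -- remaining `P (u * Q) n` scales the k-th summand by Q^k, which is the weight in `pascal-Σ`.
    cauchy : ∀ u n → P u n ≈ Σ (λ k → B n k * p u k) (suc n)
    cauchy u zero    = sym (trans (+-identityʳ _) (*-identityˡ 1#))
    cauchy u (suc n) = begin
      P u (suc n)                                                    ≈⟨ P-first u n ⟩
      (1# + u) * P (u * Q) n                                         ≈⟨ *-congˡ (cauchy (u * Q) n) ⟩
      (1# + u) * Σ (λ k → B n k * p (u * Q) k) (suc n)               ≈⟨ Σ-*ˡ _ (λ k → B n k * p (u * Q) k) (suc n) ⟩
      Σ (λ k → (1# + u) * (B n k * p (u * Q) k)) (suc n)             ≈⟨ Σ-cong (suc n) (λ k _ → step k) ⟩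
      Σ (λ k → B n k * (p u (suc k) + Q ^ k * p u k)) (suc n)        ≈⟨ pascal-Σ n (p u) ⟨
      Σ (λ k → B (suc n) k * p u k) (suc (suc n))                    ∎
      where
      step : ∀ k → (1# + u) * (B n k * p (u * Q) k) ≈ B n k * (p u (suc k) + Q ^ k * p u k)
      step k = trans (*-congˡ (*-congˡ (p-scale u Q k)))
        (solve 4 (λ u b p r → (con 1 :+ u) :* (b :* (p :* r)) := b :* (p :* (u :* r) :+ r :* p)) refl u (B n k) (p u k) (Q ^ k))

    qfact : ℕ → Carrier
    qfact = P (- Q)

    -- The factorial formula without division. The induction rests on (1 - Q^(k+1)) + Q^(k+1) (1 -
    -- Q^(l+1)) = 1 - Q^(k+l+2).
    qfact-B : ∀ k l → (qfact k * qfact l) * B (k ℕ.+ l) k ≈ qfact (k ℕ.+ l)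
    qfact-B zero    l       = trans (*-congˡ (B-zero l)) (trans (*-identityʳ _) (*-identityˡ _))
    qfact-B (suc k) zero    = begin
      (qfact (suc k) * 1#) * B (suc k ℕ.+ 0) (suc k)  ≡⟨ ≡.cong (λ m → (qfact (suc k) * 1#) * B m (suc k)) (ℕ.+-identityʳ (suc k)) ⟩
      (qfact (suc k) * 1#) * B (suc k) (suc k)        ≈⟨ *-cong (*-identityʳ _) (B-diag (suc k)) ⟩
      qfact (suc k) * 1#                              ≈⟨ *-identityʳ _ ⟩
      qfact (suc k)                                   ≡⟨ ≡.cong qfact (ℕ.+-identityʳ (suc k)) ⟨
      qfact (suc k ℕ.+ 0)                             ∎
      where
      B-diag : ∀ k → B k k ≈ 1#
      B-diag zero    = refl
      B-diag (suc k) = begin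
        B k k + Q ^ suc k * B k (suc k)  ≈⟨ +-cong (B-diag k) (trans (*-congˡ (B-vanish k (suc k) (ℕ.n<1+n k))) (zeroʳ _)) ⟩
        1# + 0#                          ≈⟨ +-identityʳ 1# ⟩
        1#                               ∎
    qfact-B (suc k) (suc l) = begin
      (qfact (suc k) * qfact (suc l)) * (B m k + Q ^ suc k * B m (suc k))
        ≈⟨ solve 7 (λ a y b z c q d → ((a :* (con 1 :+ y)) :* (b :* (con 1 :+ z))) :* (c :+ q :* d)
             := ((con 1 :+ y) :* ((a :* (b :* (con 1 :+ z))) :* c)) :+ (q :* (con 1 :+ z)) :* (((a :* (con 1 :+ y)) :* b) :* d)) refl
             (qfact k) (- Q * Q ^ k) (qfact l) (- Q * Q ^ l) (B m k) (Q ^ suc k) (B m (suc k)) ⟩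
      (1# + y) * ((qfact k * qfact (suc l)) * B m k) + (Q ^ suc k * (1# + z)) * ((qfact (suc k) * qfact l) * B m (suc k))
        ≈⟨ +-cong (*-congˡ (qfact-B k (suc l))) (*-congˡ ind) ⟩
      (1# + y) * qfact m + (Q ^ suc k * (1# + z)) * qfact m
        ≈⟨ solve 4 (λ y q z f → (con 1 :+ y) :* f :+ (q :* (con 1 :+ z)) :* f := f :* (con 1 :+ ((y :+ q) :+ q :* z))) refl y (Q ^ suc k) z (qfact m) ⟩
      qfact m * (1# + ((y + Q ^ suc k) + Q ^ suc k * z))
        ≈⟨ *-congˡ (+-congˡ (trans (+-cong cancel power) (+-identityˡ _))) ⟩
      qfact m * (1# + - Q * Q ^ m) ∎
      where
      m = k ℕ.+ suc l
      y = - Q * Q ^ k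
      z = - Q * Q ^ l
      ind : (qfact (suc k) * qfact l) * B m (suc k) ≈ qfact m
      ind = ≡.subst (λ m → (qfact (suc k) * qfact l) * B m (suc k) ≈ qfact m) (≡.sym (ℕ.+-suc k l)) (qfact-B (suc k) l)
      cancel : y + Q ^ suc k ≈ 0#
      cancel = trans (sym (distribʳ _ _ _)) (trans (*-congʳ (-‿inverseˡ Q)) (zeroˡ _))
      power : Q ^ suc k * z ≈ - Q * Q ^ m
      power = begin
        (Q * Q ^ k) * (- Q * Q ^ l)  ≈⟨ solve 4 (λ q a n b → (q :* a) :* (n :* b) := n :* (a :* (q :* b))) refl Q (Q ^ k) (- Q) (Q ^ l) ⟩
        - Q * (Q ^ k * Q ^ suc l)    ≈⟨ *-congˡ (^-homo-* Q k (suc l)) ⟨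
        - Q * Q ^ m                  ∎

    -- T u v b k is the term of index k - b of the bilateral theta series f(u, v).
    T : Carrier → Carrier → ℕ → ℕ → Carrier
    T u v zero    k       = p u k
    T u v (suc b) zero    = p v (suc b)
    T u v (suc b) (suc k) = T u v b k

    T-negative : ∀ u v k m → T u v (k ℕ.+ suc m) k ≡ p v (suc m)
    T-negative u v zero    m = ≡.refl
    T-negative u v (suc k) m = T-negative u v k m

    T-nonnegative : ∀ u v b m → T u v b (b ℕ.+ m) ≡ p u m
    T-nonnegative u v zero    m = ≡.refl
    T-nonnegative u v (suc b) m = T-nonnegative u v b m

    Σ-T : ∀ u v b a → Σ (T u v b) (b ℕ.+ a) ≈ Σ (p u) a + Σ (p v ∘ suc) b
    Σ-T u v zero    a = sym (+-identityʳ _)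
    Σ-T u v (suc b) a = begin
      p v (suc b) + Σ (T u v b) (b ℕ.+ a)                   ≈⟨ +-congˡ (Σ-T u v b a) ⟩
      p v (suc b) + (Σ (p u) a + Σ (p v ∘ suc) b)           ≈⟨ solve 3 (λ x y z → x :+ (y :+ z) := y :+ (z :+ x)) refl (p v (suc b)) _ _ ⟩
      Σ (p u) a + (Σ (p v ∘ suc) b + p v (suc b))           ≈⟨ +-congˡ (Σ-last (p v ∘ suc) b) ⟨
      Σ (p u) a + Σ (p v ∘ suc) (suc b)                     ∎

    module _ {u v : Carrier} (uv≈Q : u * v ≈ Q) where

      -- The term of index k - b is u Q^(k-b-1) times its predecessor; multiplied by v Q^b this
      -- ratio becomes Q^k, because u v = Q.
      T-step : ∀ b k → T u v b k * (v * Q ^ b) ≈ Q ^ k * T u v (suc b) k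
      T-step zero    zero    = solve 1 (λ v → con 1 :* (v :* con 1) := con 1 :* (con 1 :* (v :* con 1))) refl v
      T-step zero    (suc k) = begin
        (p u k * (u * Q ^ k)) * (v * 1#)  ≈⟨ solve 4 (λ p u r v → (p :* (u :* r)) :* (v :* con 1) := (u :* v) :* r :* p) refl (p u k) u (Q ^ k) v ⟩
        ((u * v) * Q ^ k) * p u k         ≈⟨ *-congʳ (*-congʳ uv≈Q) ⟩
        Q ^ suc k * p u k                 ∎
      T-step (suc b) zero    = sym (*-identityˡ _)
      T-step (suc b) (suc k) = begin
        T u v b k * (v * (Q * Q ^ b))       ≈⟨ solve 4 (λ t v q r → t :* (v :* (q :* r)) := q :* (t :* (v :* r))) refl (T u v b k) v Q (Q ^ b) ⟩
        Q * (T u v b k * (v * Q ^ b))       ≈⟨ *-congˡ (T-step b k) ⟩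
        Q * (Q ^ k * T u v (suc b) k)       ≈⟨ *-assoc _ _ _ ⟨
        Q ^ suc k * T u v (suc b) k         ∎

      -- With b = 0 this is `cauchy`. Each factor 1 + v Q^b moves the origin of the bilateral series
      -- by one place, and `T-step` brings the change into the form that `pascal-Σ` absorbs.
      finite-triple-product : ∀ b a → P u a * P v b ≈ Σ (λ k → B (b ℕ.+ a) k * T u v b k) (suc (b ℕ.+ a))
      finite-triple-product zero    a = trans (*-identityʳ _) (cauchy u a)
      finite-triple-product (suc b) a = begin
        P u a * (P v b * (1# + v * Q ^ b))       ≈⟨ solve 3 (λ x y z → x :* (y :* z) := z :* (x :* y)) refl _ _ _ ⟩
        (1# + v * Q ^ b) * (P u a * P v b)       ≈⟨ *-congˡ (finite-triple-product b a) ⟩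
        (1# + v * Q ^ b) * Σ (λ k → B n k * T u v b k) (suc n)
          ≈⟨ Σ-*ˡ _ (λ k → B n k * T u v b k) (suc n) ⟩
        Σ (λ k → (1# + v * Q ^ b) * (B n k * T u v b k)) (suc n)
          ≈⟨ Σ-cong (suc n) (λ k _ → step k) ⟩
        Σ (λ k → B n k * (T u v b k + Q ^ k * T u v (suc b) k)) (suc n)
          ≈⟨ pascal-Σ n (T u v (suc b)) ⟨
        Σ (λ k → B (suc n) k * T u v (suc b) k) (suc (suc n)) ∎
        where
        n = b ℕ.+ a
        step : ∀ k → (1# + v * Q ^ b) * (B n k * T u v b k) ≈ B n k * (T u v b k + Q ^ k * T u v (suc b) k)
        step k = trans (solve 3 (λ x b t → (con 1 :+ x) :* (b :* t) := b :* (t :+ t :* x)) refl (v * Q ^ b) (B n k) (T u v b k))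
                       (*-congˡ (+-congˡ (T-step b k)))

      module _ {N : ℕ} (Q^N≈0 : Q ^ N ≈ 0#)
               (unit : Carrier) (unit-inverse : unit * qfact N ≈ 1#) where

        private
          -- From N on, `qfact` no longer changes, so the factorial formula reads f f B = f;
          -- invertibility of f removes one factor. The limit 1/(Q;Q)_∞ of the binomial coefficients
          -- is thus attained.
          B-limit : ∀ k l → N ℕ.≤ k → N ℕ.≤ l → qfact N * B (k ℕ.+ l) k ≈ 1#
          B-limit k l N≤k N≤l = begin
            f * b                          ≈⟨ *-identityˡ _ ⟨
            1# * (f * b)                   ≈⟨ *-congʳ unit-inverse ⟨
            (unit * f) * (f * b)           ≈⟨ solve 3 (λ i f b → (i :* f) :* (f :* b) := i :* ((f :* f) :* b)) refl unit f b ⟩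
            unit * ((f * f) * b)           ≈⟨ *-congˡ (*-congʳ (*-cong (stable N≤k) (stable N≤l))) ⟨
            unit * ((qfact k * qfact l) * b)  ≈⟨ *-congˡ (qfact-B k l) ⟩
            unit * qfact (k ℕ.+ l)         ≈⟨ *-congˡ (stable (ℕ.≤-trans N≤k (ℕ.m≤m+n k l))) ⟩
            unit * f                       ≈⟨ unit-inverse ⟩
            1#                             ∎
            where
            f = qfact N
            b = B (k ℕ.+ l) k
            stable : ∀ {n} → N ℕ.≤ n → qfact n ≈ f
            stable = P-stable (- Q) Q^N≈0

        -- Within distance N of either end of the sum the theta term has index beyond N in absolute
        -- value, since a and b exceed 2N, and is zero. Everywhere else the binomial coefficient has
        -- reached its limit.
        triple-product : ∀ b a → N ℕ.+ N ℕ.< b → N ℕ.+ N ℕ.< a →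
          qfact N * (P u a * P v b) ≈ Σ (p u) (suc a) + Σ (p v ∘ suc) b
        triple-product b a 2N<b 2N<a = begin
          f * (P u a * P v b)                               ≈⟨ *-congˡ (finite-triple-product b a) ⟩
          f * Σ (λ k → B n k * T u v b k) (suc n)           ≈⟨ Σ-*ˡ f (λ k → B n k * T u v b k) (suc n) ⟩
          Σ (λ k → f * (B n k * T u v b k)) (suc n)         ≈⟨ Σ-cong (suc n) (λ k k≤n → term k (ℕ.≤-pred k≤n)) ⟩
          Σ (T u v b) (suc n)                               ≡⟨ ≡.cong (Σ (T u v b)) (≡.sym (ℕ.+-suc b a)) ⟩
          Σ (T u v b) (b ℕ.+ suc a)                         ≈⟨ Σ-T u v b (suc a) ⟩
          Σ (p u) (suc a) + Σ (p v ∘ suc) b                 ∎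
          where
          f = qfact N
          n = b ℕ.+ a
          zero-term : ∀ k → T u v b k ≈ 0# → f * (B n k * T u v b k) ≈ T u v b k
          zero-term k t≈0 = begin
            f * (B n k * T u v b k)  ≈⟨ *-congˡ (trans (*-congˡ t≈0) (zeroʳ _)) ⟩
            f * 0#                   ≈⟨ zeroʳ f ⟩
            0#                       ≈⟨ t≈0 ⟨
            T u v b k                ∎
          low : ∀ k → k ℕ.< N → T u v b k ≈ 0#
          low k k<N = begin
            T u v b k                             ≡⟨ ≡.cong (λ b → T u v b k) b≡ ⟩
            T u v (k ℕ.+ suc (b ℕ.∸ suc k)) k     ≡⟨ T-negative u v k _ ⟩
            p v (suc (b ℕ.∸ suc k))               ≈⟨ p-vanish v Q^N≈0 (s≤s (ℕ.m+n≤o⇒m≤o∸n N N+k<b)) ⟩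
            0#                                    ∎
            where
            k<b : k ℕ.< b
            k<b = ℕ.<-trans (ℕ.<-≤-trans k<N (ℕ.m≤m+n N N)) 2N<b
            b≡ : b ≡ k ℕ.+ suc (b ℕ.∸ suc k)
            b≡ = ≡.trans (≡.sym (ℕ.m+[n∸m]≡n k<b)) (≡.sym (ℕ.+-suc k _))
            N+k<b : N ℕ.+ suc k ℕ.≤ b
            N+k<b = ℕ.≤-trans (ℕ.+-monoʳ-≤ N k<N) (ℕ.<⇒≤ 2N<b)
          high : ∀ k → k ℕ.≤ n → n ℕ.∸ k ℕ.< N → T u v b k ≈ 0#
          high k k≤n n∸k<N = begin
            T u v b k                    ≡⟨ ≡.cong (T u v b) (ℕ.m+[n∸m]≡n b≤k) ⟨
            T u v b (b ℕ.+ (k ℕ.∸ b))    ≡⟨ T-nonnegative u v b _ ⟩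
            p u (k ℕ.∸ b)                ≈⟨ p-vanish u Q^N≈0 (ℕ.m+n≤o⇒m≤o∸n (suc N) N+b<k) ⟩
            0#                           ∎
            where
            n<k+N : n ℕ.< k ℕ.+ N
            n<k+N = ≡.subst (ℕ._< k ℕ.+ N) (ℕ.m+[n∸m]≡n k≤n) (ℕ.+-monoʳ-< k n∸k<N)
            N+b<k : suc N ℕ.+ b ℕ.≤ k
            N+b<k = ℕ.+-cancelʳ-≤ N _ _ (ℕ.≤-trans (ℕ.≤-trans (ℕ.≤-reflexive eq)
                      (ℕ.+-monoʳ-≤ b 2N<a)) (ℕ.<⇒≤ n<k+N))
              where
              eq : suc N ℕ.+ b ℕ.+ N ≡ b ℕ.+ suc (N ℕ.+ N)
              eq = ≡.trans (≡.cong (ℕ._+ N) (ℕ.+-comm (suc N) b)) (ℕ.+-assoc b (suc N) N)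
            b≤k : b ℕ.≤ k
            b≤k = ℕ.≤-trans (ℕ.m≤n+m b (suc N)) N+b<k
          term : ∀ k → k ℕ.≤ n → f * (B n k * T u v b k) ≈ T u v b k
          term k k≤n with k ℕ.<? N | (n ℕ.∸ k) ℕ.<? N
          ... | yes k<N | _       = zero-term k (low k k<N)
          ... | no  _   | yes l<N = zero-term k (high k k≤n l<N)
          ... | no  k≮N | no  l≮N = begin
            f * (B n k * T u v b k)    ≈⟨ *-assoc _ _ _ ⟨
            (f * B n k) * T u v b k    ≡⟨ ≡.cong (λ n → (f * B n k) * T u v b k) (ℕ.m+[n∸m]≡n k≤n) ⟨
            (f * B (k ℕ.+ (n ℕ.∸ k)) k) * T u v b k
              ≈⟨ *-congʳ (B-limit k (n ℕ.∸ k) (ℕ.≮⇒≥ k≮N) (ℕ.≮⇒≥ l≮N)) ⟩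
            1# * T u v b k             ≈⟨ *-identityˡ _ ⟩
            T u v b k                  ∎

  open Gauss using (P; p)

  -- Manipulation of finite products and sums

  P-cong₂ : ∀ {Q Q' u u'} n → Q ≈ Q' → u ≈ u' → P Q u n ≈ P Q' u' n
  P-cong₂ zero    e e' = refl
  P-cong₂ (suc n) e e' = *-cong (P-cong₂ n e e') (+-congˡ (*-cong e' (^-congˡ n e)))

  *-neg-square : ∀ u → u * - u ≈ - (u * u)
  *-neg-square u = sym (-‿distribʳ-* u u)

  square-neg : ∀ x → - x * - x ≈ x * x
  square-neg x = trans (sym (-‿distribˡ-* x (- x))) (trans (-‿cong (*-neg-square x)) (-‿involutive _))

  P-conjugate : ∀ Q u n → P Q u n * P Q (- u) n ≈ P (Q * Q) (- (u * u)) n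
  P-conjugate Q u zero    = *-identityʳ 1#
  P-conjugate Q u (suc n) = begin
    (P Q u n * (1# + u * r)) * (P Q (- u) n * (1# + - u * r))
      ≈⟨ solve 5 (λ a b u v r → (a :* (con 1 :+ u :* r)) :* (b :* (con 1 :+ v :* r))
           := (a :* b) :* (con 1 :+ ((u :+ v) :* r :+ (u :* v) :* (r :* r)))) refl (P Q u n) (P Q (- u) n) u (- u) r ⟩
    (P Q u n * P Q (- u) n) * (1# + ((u + - u) * r + (u * - u) * (r * r)))
      ≈⟨ *-cong (P-conjugate Q u n) (+-congˡ (trans (+-cong cancel (*-cong (*-neg-square u) (sym (^-distrib-* Q Q n)))) (+-identityˡ _))) ⟩
    P (Q * Q) (- (u * u)) (suc n) ∎
    where
    r = Q ^ n
    cancel : (u + - u) * r ≈ 0#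
    cancel = trans (*-congʳ (-‿inverseʳ u)) (zeroˡ r)

  ^-double : ∀ Q n → Q ^ (n ℕ.+ n) ≈ (Q * Q) ^ n
  ^-double Q n = trans (^-homo-* Q n n) (sym (^-distrib-* Q Q n))

  P-split : ∀ Q u n → P Q u (n ℕ.+ n) ≈ P (Q * Q) u n * P (Q * Q) (u * Q) n
  P-split Q u zero    = sym (*-identityʳ 1#)
  P-split Q u (suc n) = begin
    P Q u (suc (n ℕ.+ suc n))
      ≡⟨ ≡.cong (λ m → P Q u (suc m)) (ℕ.+-suc n n) ⟩
    (P Q u (n ℕ.+ n) * (1# + u * Q ^ (n ℕ.+ n))) * (1# + u * (Q * Q ^ (n ℕ.+ n)))
      ≈⟨ *-cong (*-cong (P-split Q u n) (+-congˡ (*-congˡ (^-double Q n)))) (+-congˡ (*-congˡ (*-congˡ (^-double Q n)))) ⟩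
    ((P (Q * Q) u n * P (Q * Q) (u * Q) n) * (1# + u * r)) * (1# + u * (Q * r))
      ≈⟨ solve 5 (λ a b u q r → ((a :* b) :* (con 1 :+ u :* r)) :* (con 1 :+ u :* (q :* r))
           := (a :* (con 1 :+ u :* r)) :* (b :* (con 1 :+ (u :* q) :* r))) refl _ _ u Q r ⟩
    P (Q * Q) u (suc n) * P (Q * Q) (u * Q) (suc n) ∎
    where r = (Q * Q) ^ n

  p-one-suc : ∀ Q k → p Q 1# (suc k) ≈ p Q Q k
  p-one-suc Q zero    = trans (*-identityˡ _) (*-identityˡ _)
  p-one-suc Q (suc k) = *-cong (p-one-suc Q k) (*-identityˡ _)

  p-cong : ∀ Q {u v} k → u ≈ v → p Q u k ≈ p Q v k
  p-cong Q zero    e = refl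
  p-cong Q (suc k) e = *-cong (p-cong Q k e) (*-congʳ e)

  Σ-double : ∀ g n → Σ g (n ℕ.+ n) ≈ Σ (λ k → g (k ℕ.+ k)) n + Σ (λ k → g (suc (k ℕ.+ k))) n
  Σ-double g zero    = sym (+-identityˡ 0#)
  Σ-double g (suc n) = begin
    Σ g (suc (n ℕ.+ suc n))
      ≡⟨ ≡.cong (λ m → Σ g (suc m)) (ℕ.+-suc n n) ⟩
    Σ g (suc (suc (n ℕ.+ n)))
      ≈⟨ trans (Σ-last g _) (+-congʳ (Σ-last g _)) ⟩
    (Σ g (n ℕ.+ n) + g (n ℕ.+ n)) + g (suc (n ℕ.+ n))
      ≈⟨ +-congʳ (+-congʳ (Σ-double g n)) ⟩
    ((Σ even n + Σ odd n) + even n) + odd n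
      ≈⟨ solve 4 (λ a b c d → ((a :+ b) :+ c) :+ d := (a :+ c) :+ (b :+ d)) refl (Σ even n) (Σ odd n) (even n) (odd n) ⟩
    (Σ even n + even n) + (Σ odd n + odd n)
      ≈⟨ +-cong (Σ-last even n) (Σ-last odd n) ⟨
    Σ even (suc n) + Σ odd (suc n) ∎
    where
    even odd : ℕ → Carrier
    even k = g (k ℕ.+ k)
    odd  k = g (suc (k ℕ.+ k))

  geometric : ∀ z n → (1# + - z) * Σ (z ^_) n + z ^ n ≈ 1#
  geometric z zero    = trans (+-congʳ (zeroʳ _)) (+-identityˡ 1#)
  geometric z (suc n) = begin
    (1# + - z) * Σ (z ^_) (suc n) + z * z ^ n
      ≈⟨ +-congʳ (*-congˡ (Σ-last (z ^_) n)) ⟩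
    (1# + - z) * (Σ (z ^_) n + z ^ n) + z * z ^ n
      ≈⟨ solve 4 (λ m s r z → (con 1 :+ m) :* (s :+ r) :+ z :* r := ((con 1 :+ m) :* s :+ r) :+ (m :+ z) :* r) refl (- z) (Σ (z ^_) n) (z ^ n) z ⟩
    ((1# + - z) * Σ (z ^_) n + z ^ n) + (- z + z) * z ^ n
      ≈⟨ +-cong (geometric z n) (trans (*-congʳ (-‿inverseˡ z)) (zeroˡ _)) ⟩
    1# + 0#
      ≈⟨ +-identityʳ 1# ⟩
    1# ∎

  -- The theta functions and Euler's product, truncated to N factors: exact at y with y ^ N ≈ 0.
  module Truncated (N : ℕ) where

    F : Carrier → Carrier
    F y = P y (- y) N

    -- Product side of the triple product with Q = w^2 and u = v = w, that is, φ(w). Likewise `Ψ`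
    -- comes from Q = u = y and v = 1, with the factor 1 + v = 2 left out.
    Φ : Carrier → Carrier
    Φ w = F (w * w) * (P (w * w) w N * P (w * w) w N)

    Ψ : Carrier → Carrier
    Ψ y = F y * (P y y N * P y y N)

    F-cong : ∀ {y z} → y ≈ z → F y ≈ F z
    F-cong e = P-cong₂ N e (-‿cong e)

    Φ-cong : ∀ {y z} → y ≈ z → Φ y ≈ Φ z
    Φ-cong e = *-cong (F-cong (*-cong e e)) (*-cong p≈ p≈)
      where p≈ = P-cong₂ N (*-cong e e) e

    Ψ-cong : ∀ {y z} → y ≈ z → Ψ y ≈ Ψ z
    Ψ-cong e = *-cong (F-cong e) (*-cong p≈ p≈)
      where p≈ = P-cong₂ N e e

    Nilpotent : Carrier → Set ℓ
    Nilpotent y = y ^ N ≈ 0#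

    *-nilpotent : ∀ z {y} → Nilpotent y → Nilpotent (z * y)
    *-nilpotent z {y} y^N≈0 = trans (^-distrib-* z y N) (trans (*-congˡ y^N≈0) (zeroʳ _))

    -‿nilpotent : ∀ {y} → Nilpotent y → Nilpotent (- y)
    -‿nilpotent {y} y^N≈0 = trans (^-congˡ N (trans (-‿cong (sym (*-identityˡ y))) (-‿distribˡ-* 1# y))) (*-nilpotent (- 1#) y^N≈0)

    -- Each factor 1 - y^(n+1) is inverted by its geometric series, of which N terms suffice because
    -- y^N vanishes.
    F⁻¹-upTo : Carrier → ℕ → Carrier
    F⁻¹-upTo y zero    = 1#
    F⁻¹-upTo y (suc n) = F⁻¹-upTo y n * Σ ((y * y ^ n) ^_) N

    F⁻¹ : Carrier → Carrier
    F⁻¹ y = F⁻¹-upTo y N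

    F⁻¹-inverse : ∀ {y} → Nilpotent y → F⁻¹ y * F y ≈ 1#
    F⁻¹-inverse {y} y^N≈0 = go N
      where
      go : ∀ n → F⁻¹-upTo y n * P y (- y) n ≈ 1#
      go zero    = *-identityʳ 1#
      go (suc n) = begin
        (F⁻¹-upTo y n * g) * (P y (- y) n * (1# + - y * y ^ n))
          ≈⟨ solve 4 (λ a g b c → (a :* g) :* (b :* c) := (a :* b) :* (c :* g)) refl (F⁻¹-upTo y n) g (P y (- y) n) _ ⟩
        (F⁻¹-upTo y n * P y (- y) n) * ((1# + - y * y ^ n) * g)
          ≈⟨ *-cong (go n) (*-congʳ (+-congˡ (sym (-‿distribˡ-* y (y ^ n))))) ⟩
        1# * ((1# + - z) * g)
          ≈⟨ *-identityˡ _ ⟩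
        (1# + - z) * g
          ≈⟨ +-identityʳ _ ⟨
        (1# + - z) * g + 0#
          ≈⟨ +-congˡ (trans (^-congˡ N (*-comm y (y ^ n))) (*-nilpotent (y ^ n) y^N≈0)) ⟨
        (1# + - z) * g + z ^ N
          ≈⟨ geometric z N ⟩
        1# ∎
        where
        z = y * y ^ n
        g = Σ (z ^_) N

    F-split : ∀ {y} → Nilpotent y → F y ≈ P (y * y) (- y) N * F (y * y)
    F-split {y} y^N≈0 = begin
      P y (- y) N                                   ≈⟨ Gauss.P-stable y (- y) y^N≈0 (ℕ.m≤m+n N N) ⟨
      P y (- y) (N ℕ.+ N)                           ≈⟨ P-split y (- y) N ⟩
      P (y * y) (- y) N * P (y * y) (- y * y) N     ≈⟨ *-congˡ (P-cong₂ N refl (-‿distribˡ-* y y)) ⟨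
      P (y * y) (- y) N * F (y * y)                 ∎

    -- This and the two lemmas that follow are φ(-q) = f_1^2 / f_2, φ(q) = f_2^5 / (f_1^2 f_4^2) and
    -- ψ(q) = f_2^2 / f_1, with the denominators cleared.
    Φ-negative : ∀ {x} → Nilpotent x → Φ (- x) * F (x * x) ≈ F x * F x
    Φ-negative {x} x^N≈0 = begin
      Φ (- x) * F (x * x)
        ≈⟨ *-congʳ (*-cong (F-cong [-x]²) (*-cong p≈ p≈)) ⟩
      (F (x * x) * (o * o)) * F (x * x)
        ≈⟨ solve 2 (λ f o → (f :* (o :* o)) :* f := (o :* f) :* (o :* f)) refl (F (x * x)) o ⟩
      (o * F (x * x)) * (o * F (x * x))
        ≈⟨ *-cong (F-split x^N≈0) (F-split x^N≈0) ⟨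
      F x * F x ∎
      where
      o = P (x * x) (- x) N
      [-x]² = square-neg x
      p≈ : P (- x * - x) (- x) N ≈ o
      p≈ = P-cong₂ N [-x]² refl

    Φ-positive : ∀ {x} → Nilpotent x →
      Φ x * ((F x * F x) * (F ((x * x) * (x * x)) * F ((x * x) * (x * x)))) ≈ F (x * x) ^ 5
    Φ-positive {x} x^N≈0 = begin
      (f₂ * (e * e)) * ((F x * F x) * (f₄ * f₄))
        ≈⟨ solve 4 (λ f₂ e f₁ f₄ → (f₂ :* (e :* e)) :* ((f₁ :* f₁) :* (f₄ :* f₄)) := f₂ :* (((e :* f₁) :* f₄) :* ((e :* f₁) :* f₄))) refl f₂ e (F x) f₄ ⟩
      f₂ * (((e * F x) * f₄) * ((e * F x) * f₄))
        ≈⟨ *-congˡ (*-cong lemma lemma) ⟩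
      f₂ * ((f₂ * f₂) * (f₂ * f₂))
        ≈⟨ solve 1 (λ f → f :* ((f :* f) :* (f :* f)) := f :^ 5) refl f₂ ⟩
      f₂ ^ 5 ∎
      where
      f₂ = F (x * x)
      f₄ = F ((x * x) * (x * x))
      e = P (x * x) x N
      lemma : (e * F x) * f₄ ≈ f₂ * f₂
      lemma = begin
        (e * F x) * f₄                            ≈⟨ *-congʳ (*-congˡ (F-split x^N≈0)) ⟩
        (e * (P (x * x) (- x) N * f₂)) * f₄       ≈⟨ solve 4 (λ e o f g → (e :* (o :* f)) :* g := ((e :* o) :* g) :* f) refl e (P (x * x) (- x) N) f₂ f₄ ⟩
        ((e * P (x * x) (- x) N) * f₄) * f₂       ≈⟨ *-congʳ (*-congʳ (P-conjugate (x * x) x N)) ⟩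
        (P ((x * x) * (x * x)) (- (x * x)) N * f₄) * f₂  ≈⟨ *-congʳ (F-split (*-nilpotent x x^N≈0)) ⟨
        f₂ * f₂                                   ∎

    Ψ-product : ∀ y → Ψ y * F y ≈ F (y * y) * F (y * y)
    Ψ-product y = begin
      (F y * (e * e)) * F y      ≈⟨ solve 2 (λ f e → (f :* (e :* e)) :* f := (e :* f) :* (e :* f)) refl (F y) e ⟩
      (e * F y) * (e * F y)      ≈⟨ *-cong (P-conjugate y y N) (P-conjugate y y N) ⟩
      F (y * y) * F (y * y)      ∎
      where e = P y y N

    -- Pairing the factors 1 + w^i and 1 - w^i for odd i gives both the product in φ(-w^2) and the
    -- quotient f_2 / f_4. Through this identity the dissection of φ(-w^2)^2 follows from the
    -- dissections of φ(w) and φ(-w).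
    Φ-conjugate : ∀ {w} → Nilpotent w → Φ w * Φ (- w) ≈ Φ (- (w * w)) * Φ (- (w * w))
    Φ-conjugate {w} w^N≈0 = begin
      (f₂ * (e * e)) * Φ (- w)
        ≈⟨ *-congˡ (*-cong (F-cong [-w]²) (*-cong p≈ p≈)) ⟩
      (f₂ * (e * e)) * (f₂ * (o * o))
        ≈⟨ solve 3 (λ f e o → (f :* (e :* e)) :* (f :* (o :* o)) := (f :* f) :* ((e :* o) :* (e :* o))) refl f₂ e o ⟩
      (f₂ * f₂) * ((e * o) * (e * o))
        ≈⟨ *-cong (*-cong f₂-split f₂-split) (*-cong (P-conjugate (w * w) w N) (P-conjugate (w * w) w N)) ⟩
      ((d * f₄) * (d * f₄)) * (d * d)
        ≈⟨ solve 2 (λ d f → ((d :* f) :* (d :* f)) :* (d :* d) := (f :* (d :* d)) :* (f :* (d :* d))) refl d f₄ ⟩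
      (f₄ * (d * d)) * (f₄ * (d * d))
        ≈⟨ *-cong Φ₂ Φ₂ ⟨
      Φ (- (w * w)) * Φ (- (w * w)) ∎
      where
      f₂ = F (w * w)
      f₄ = F ((w * w) * (w * w))
      e = P (w * w) w N
      o = P (w * w) (- w) N
      d = P ((w * w) * (w * w)) (- (w * w)) N
      [-w]² = square-neg w
      p≈ : P (- w * - w) (- w) N ≈ o
      p≈ = P-cong₂ N [-w]² refl
      f₂-split : f₂ ≈ d * f₄
      f₂-split = F-split (*-nilpotent w w^N≈0)
      Φ₂ : Φ (- (w * w)) ≈ f₄ * (d * d)
      Φ₂ = *-cong (F-cong (square-neg (w * w))) (*-cong d≈ d≈)
        where d≈ = P-cong₂ N (square-neg (w * w)) refl

    2# : Carrier
    2# = 1# + 1#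

    Φ-series : ∀ {w} → Nilpotent w → ∀ n → N ℕ.+ N ℕ.< n → Φ w ≈ 1# + 2# * Σ (p (w * w) w ∘ suc) n
    Φ-series {w} w^N≈0 n 2N<n = begin
      F W * (P W w N * P W w N)                     ≈⟨ *-congˡ (*-cong stable stable) ⟨
      F W * (P W w n * P W w n)                     ≈⟨ Gauss.triple-product W refl {N} W^N≈0 (F⁻¹ W) (F⁻¹-inverse W^N≈0) n n 2N<n 2N<n ⟩
      (1# + S) + S                                  ≈⟨ solve 1 (λ s → (con 1 :+ s) :+ s := con 1 :+ (con 1 :+ con 1) :* s) refl S ⟩
      1# + 2# * S                                   ∎
      where
      W = w * w
      S = Σ (p W w ∘ suc) n
      W^N≈0 = *-nilpotent w w^N≈0
      stable = Gauss.P-stable W w W^N≈0 (ℕ.≤-trans (ℕ.m≤m+n N N) (ℕ.<⇒≤ 2N<n))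

    -- At v = 1 the two halves of the bilateral series coincide, so the triple product yields
    -- everything twice. The 2 is not cancelled, as it need not be invertible in a general ring; the
    -- dissection of φ contains 2ψ anyway.
    Ψ-series : ∀ {y} → Nilpotent y → ∀ n → N ℕ.+ N ℕ.< n → 2# * Ψ y ≈ 2# * Σ (p y y) (suc n)
    Ψ-series {y} y^N≈0 n 2N<n = begin
      2# * (F y * (P y y N * P y y N))          ≈⟨ *-congˡ (*-congˡ (*-cong stable stable)) ⟨
      2# * (F y * (P y y n * P y y n))          ≈⟨ solve 3 (λ t f e → t :* (f :* (e :* e)) := f :* (e :* (t :* e))) refl 2# (F y) (P y y n) ⟩
      F y * (P y y n * (2# * P y y n))          ≈⟨ *-congˡ (*-congˡ (trans (Gauss.P-first y 1# n) (*-congˡ (P-cong₂ n refl (*-identityˡ y))))) ⟨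
      F y * (P y y n * P y 1# (suc n))          ≈⟨ Gauss.triple-product y (*-identityʳ y) {N} y^N≈0 (F⁻¹ y) (F⁻¹-inverse y^N≈0) (suc n) n (ℕ.m<n⇒m<1+n 2N<n) 2N<n ⟩
      S + Σ (p y 1# ∘ suc) (suc n)              ≈⟨ +-congˡ (Σ-cong (suc n) (λ k _ → p-one-suc y k)) ⟩
      S + S                                     ≈⟨ solve 1 (λ s → s :+ s := (con 1 :+ con 1) :* s) refl S ⟩
      2# * S                                    ∎
      where
      S = Σ (p y y) (suc n)
      stable = Gauss.P-stable y y y^N≈0 (ℕ.≤-trans (ℕ.m≤m+n N N) (ℕ.<⇒≤ 2N<n))

    module _ (w : Carrier) where
      private
        W = w * w
        w₄ = W * W
        w₈ = w₄ * w₄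

        w₄^ : ∀ k → w₄ ^ k ≈ W ^ k * W ^ k
        w₄^ = ^-distrib-* W W

        w₈^ : ∀ k → w₈ ^ k ≈ (W ^ k * W ^ k) * (W ^ k * W ^ k)
        w₈^ k = trans (^-distrib-* w₄ w₄ k) (*-cong (w₄^ k) (w₄^ k))

      -- Here `p W w n` is w^(n^2). An even square is 4k^2, a square in the exponent of w^4; an odd
      -- one is (2k+1)^2 = 1 + 8 k(k+1)/2, which makes `p-odd` a triangular power of w^8.
      p-even : ∀ k → p W w (k ℕ.+ k) ≈ p w₈ w₄ k
      p-even zero    = refl
      p-even (suc k) = begin
        p W w (suc (k ℕ.+ suc k))
          ≡⟨ ≡.cong (λ m → p W w (suc m)) (ℕ.+-suc k k) ⟩
        (p W w (k ℕ.+ k) * (w * W ^ (k ℕ.+ k))) * (w * (W * W ^ (k ℕ.+ k)))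
          ≈⟨ *-cong (*-cong (p-even k) (*-congˡ (^-homo-* W k k))) (*-congˡ (*-congˡ (^-homo-* W k k))) ⟩
        (p w₈ w₄ k * (w * (r * r))) * (w * (W * (r * r)))
          ≈⟨ solve 3 (λ p w r → (p :* (w :* (r :* r))) :* (w :* ((w :* w) :* (r :* r)))
               := p :* (((w :* w) :* (w :* w)) :* ((r :* r) :* (r :* r)))) refl (p w₈ w₄ k) w r ⟩
        p w₈ w₄ k * (w₄ * ((r * r) * (r * r)))
          ≈⟨ *-congˡ (*-congˡ (w₈^ k)) ⟨
        p w₈ w₄ (suc k) ∎
        where r = W ^ k

      p-odd : ∀ k → p W w (suc (k ℕ.+ k)) ≈ w * p w₈ w₈ k
      p-odd k = begin
        p W w (k ℕ.+ k) * (w * W ^ (k ℕ.+ k))  ≈⟨ *-cong (p-even k) (*-congˡ (^-homo-* W k k)) ⟩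
        p w₈ w₄ k * (w * (W ^ k * W ^ k))      ≈⟨ *-congˡ (*-congˡ (w₄^ k)) ⟨
        p w₈ w₄ k * (w * w₄ ^ k)               ≈⟨ solve 3 (λ p w s → p :* (w :* s) := w :* (p :* s)) refl (p w₈ w₄ k) w _ ⟩
        w * (p w₈ w₄ k * w₄ ^ k)               ≈⟨ *-congˡ (Gauss.p-scale w₈ w₄ w₄ k) ⟨
        w * p w₈ w₈ k                          ∎

      Φ-dissection : Nilpotent w → Φ w ≈ Φ w₄ + w * (2# * Ψ w₈)
      Φ-dissection w^N≈0 = begin
        Φ w
          ≈⟨ Φ-series w^N≈0 (m ℕ.+ m) (ℕ.<-≤-trans 2N<m (ℕ.m≤m+n m m)) ⟩
        1# + 2# * Σ (p W w ∘ suc) (m ℕ.+ m)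
          ≈⟨ +-congˡ (*-congˡ (Σ-double (p W w ∘ suc) m)) ⟩
        1# + 2# * (Σ (λ k → p W w (suc (k ℕ.+ k))) m + Σ (λ k → p W w (suc (suc (k ℕ.+ k)))) m)
          ≈⟨ +-congˡ (*-congˡ (+-cong odd even)) ⟩
        1# + 2# * (w * Σ (p w₈ w₈) m + Σ (p w₈ w₄ ∘ suc) m)
          ≈⟨ solve 4 (λ t w a b → con 1 :+ t :* (w :* a :+ b) := (con 1 :+ t :* b) :+ w :* (t :* a)) refl 2# w _ _ ⟩
        (1# + 2# * Σ (p w₈ w₄ ∘ suc) m) + w * (2# * Σ (p w₈ w₈) m)
          ≈⟨ +-cong (Φ-series w₄^N≈0 m 2N<m) (*-congˡ (Ψ-series (*-nilpotent w₄ w₄^N≈0) (suc (N ℕ.+ N)) ℕ.≤-refl)) ⟨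
        Φ w₄ + w * (2# * Ψ w₈) ∎
        where
        -- This length suits both halves: `Ψ-series` with bound 2N + 1 has 2N + 2 terms.
        m = suc (suc (N ℕ.+ N))
        2N<m : N ℕ.+ N ℕ.< m
        2N<m = ℕ.m<n⇒m<1+n ℕ.≤-refl
        w₄^N≈0 = *-nilpotent W (*-nilpotent w w^N≈0)
        odd : Σ (λ k → p W w (suc (k ℕ.+ k))) m ≈ w * Σ (p w₈ w₈) m
        odd = trans (Σ-cong m (λ k _ → p-odd k)) (sym (Σ-*ˡ w (p w₈ w₈) m))
        even : Σ (λ k → p W w (suc (suc (k ℕ.+ k)))) m ≈ Σ (p w₈ w₄ ∘ suc) m
        even = Σ-cong m (λ k _ → trans (reflexive (≡.cong (λ j → p W w (suc j)) (≡.sym (ℕ.+-suc k k)))) (p-even (suc k)))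

    -- Jacobi's identity for the cube of Euler's product

    jacobiTerm : Carrier → ℕ → Carrier
    jacobiTerm x k = ((- 1#) ^ k * (1# + 2# * (k ×′ 1#))) * p x x k

    -- The triple product at u = - (1 + ε) x, v = - (1 - ε): since ε² = 0, it extracts the
    -- derivative in the Jacobi variable at the zero of the product.
    module _ {x ε : Carrier} (x^N≈0 : Nilpotent x) (ε²≈0 : ε * ε ≈ 0#) where
      private
        n₁ = - 1#
        ε' = n₁ * ε
        a = n₁ * (1# + ε)
        b = n₁ * (1# + ε')

        n₁²≈1 : n₁ * n₁ ≈ 1#
        n₁²≈1 = trans (square-neg 1#) (*-identityˡ 1#)

        ε'²≈0 : ε' * ε' ≈ 0#
        ε'²≈0 = trans (solve 2 (λ n e → (n :* e) :* (n :* e) := (n :* n) :* (e :* e)) refl n₁ ε) (trans (*-congˡ ε²≈0) (zeroʳ _))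

        ε+ε'≈0 : ε + ε' ≈ 0#
        ε+ε'≈0 = trans (solve 2 (λ n e → e :+ n :* e := (con 1 :+ n) :* e) refl n₁ ε) (trans (*-congʳ (-‿inverseʳ 1#)) (zeroˡ ε))

        ab≈1 : a * b ≈ 1#
        ab≈1 = begin
          (n₁ * (1# + ε)) * (n₁ * (1# + n₁ * ε))
            ≈⟨ solve 2 (λ n e → (n :* (con 1 :+ e)) :* (n :* (con 1 :+ n :* e)) := (n :* n) :* (con 1 :+ ((e :+ n :* e) :+ n :* (e :* e)))) refl n₁ ε ⟩
          (n₁ * n₁) * (1# + ((ε + ε') + n₁ * (ε * ε)))
            ≈⟨ *-cong n₁²≈1 (+-congˡ (+-cong ε+ε'≈0 (trans (*-congˡ ε²≈0) (zeroʳ n₁)))) ⟩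
          1# * (1# + (0# + 0#))
            ≈⟨ solve 0 (con 1 :* (con 1 :+ (con 0 :+ con 0)) := con 1) refl ⟩
          1# ∎

        1+b≈ε : 1# + b ≈ ε
        1+b≈ε = begin
          1# + n₁ * (1# + n₁ * ε)       ≈⟨ solve 2 (λ n e → con 1 :+ n :* (con 1 :+ n :* e) := (con 1 :+ n) :+ (n :* n) :* e) refl n₁ ε ⟩
          (1# + n₁) + (n₁ * n₁) * ε     ≈⟨ +-cong (-‿inverseʳ 1#) (*-congʳ n₁²≈1) ⟩
          0# + 1# * ε                   ≈⟨ trans (+-identityˡ _) (*-identityˡ ε) ⟩
          ε                             ∎

        ^-linear : ∀ {η} → η * η ≈ 0# → ∀ k → (1# + η) ^ k ≈ 1# + (k ×′ 1#) * η
        ^-linear {η} η²≈0 zero    = sym (trans (+-congˡ (zeroˡ η)) (+-identityʳ 1#))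
        ^-linear {η} η²≈0 (suc k) = begin
          (1# + η) * (1# + η) ^ k                 ≈⟨ *-congˡ (^-linear η²≈0 k) ⟩
          (1# + η) * (1# + (k ×′ 1#) * η)          ≈⟨ solve 2 (λ e m → (con 1 :+ e) :* (con 1 :+ m :* e) := con 1 :+ ((con 1 :+ m) :* e :+ m :* (e :* e))) refl η (k ×′ 1#) ⟩
          1# + ((1# + k ×′ 1#) * η + (k ×′ 1#) * (η * η))
            ≈⟨ +-congˡ (trans (+-congˡ (trans (*-congˡ η²≈0) (zeroʳ _))) (+-identityʳ _)) ⟩
          1# + (1# + k ×′ 1#) * η                  ∎

        -- Terms k and -(k+1) of the bilateral series share the power of x. Their constant parts
        -- (-1)^k and (-1)^(k+1) cancel, and the linear parts contribute k and k + 1, whence 2k + 1.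
        power-sum : ∀ k → a ^ k + b ^ suc k ≈ ε * (n₁ ^ k * (1# + 2# * (k ×′ 1#)))
        power-sum k = begin
          a ^ k + b ^ suc k
            ≈⟨ +-cong (trans (^-distrib-* n₁ _ k) (*-congˡ (^-linear ε²≈0 k)))
                      (trans (^-distrib-* n₁ _ (suc k)) (*-congˡ (^-linear ε'²≈0 (suc k)))) ⟩
          n₁ ^ k * (1# + m * ε) + (n₁ * n₁ ^ k) * (1# + (1# + m) * (n₁ * ε))
            ≈⟨ solve 4 (λ n s m e → s :* (con 1 :+ m :* e) :+ (n :* s) :* (con 1 :+ (con 1 :+ m) :* (n :* e))
                 := s :* ((con 1 :+ n) :+ (m :* e :+ (con 1 :+ m) :* ((n :* n) :* e)))) refl n₁ (n₁ ^ k) m ε ⟩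
          n₁ ^ k * ((1# + n₁) + (m * ε + (1# + m) * ((n₁ * n₁) * ε)))
            ≈⟨ *-congˡ (+-cong (-‿inverseʳ 1#) (+-congˡ (*-congˡ (*-congʳ n₁²≈1)))) ⟩
          n₁ ^ k * (0# + (m * ε + (1# + m) * (1# * ε)))
            ≈⟨ solve 3 (λ s m e → s :* (con 0 :+ (m :* e :+ (con 1 :+ m) :* (con 1 :* e))) := e :* (s :* (con 1 :+ (con 1 :+ con 1) :* m))) refl (n₁ ^ k) m ε ⟩
          ε * (n₁ ^ k * (1# + 2# * m)) ∎
          where m = k ×′ 1#

        -- Behind a factor ε only the values modulo the annihilator of ε matter, so -(1 + ε) x and
        -- -(1 - ε) x may both be replaced by -x.
        ε-P : ∀ {u v} n → ε * u ≈ ε * v → ε * P x u n ≈ ε * P x v n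
        ε-P zero    e = refl
        ε-P {u} {v} (suc n) e = begin
          ε * (P x u n * (1# + u * r))     ≈⟨ *-assoc _ _ _ ⟨
          (ε * P x u n) * (1# + u * r)     ≈⟨ *-congʳ (ε-P n e) ⟩
          (ε * P x v n) * (1# + u * r)     ≈⟨ solve 4 (λ e p u r → (e :* p) :* (con 1 :+ u :* r) := p :* (e :+ (e :* u) :* r)) refl ε (P x v n) u r ⟩
          P x v n * (ε + (ε * u) * r)      ≈⟨ *-congˡ (+-congˡ (*-congʳ e)) ⟩
          P x v n * (ε + (ε * v) * r)      ≈⟨ solve 4 (λ e p u r → p :* (e :+ (e :* u) :* r) := e :* (p :* (con 1 :+ u :* r))) refl ε (P x v n) v r ⟩
          ε * (P x v n * (1# + v * r))     ∎
          where r = x ^ n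

        ε*-x : ∀ {η} → ε * η ≈ 0# → ε * (x * (n₁ * (1# + η))) ≈ ε * - x
        ε*-x {η} εη≈0 = begin
          ε * (x * (n₁ * (1# + η)))        ≈⟨ solve 4 (λ e x n h → e :* (x :* (n :* (con 1 :+ h))) := (n :* x) :* (e :+ e :* h)) refl ε x n₁ η ⟩
          (n₁ * x) * (ε + ε * η)           ≈⟨ *-cong (trans (sym (-‿distribˡ-* 1# x)) (-‿cong (*-identityˡ x))) (trans (+-congˡ εη≈0) (+-identityʳ ε)) ⟩
          - x * ε                          ≈⟨ *-comm _ _ ⟩
          ε * - x                          ∎

        εε'≈0 : ε * ε' ≈ 0#
        εε'≈0 = trans (solve 2 (λ e n → e :* (n :* e) := n :* (e :* e)) refl ε n₁) (trans (*-congˡ ε²≈0) (zeroʳ n₁))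

      jacobi : ε * (F x * (F x * F x)) ≈ ε * Σ (jacobiTerm x) (suc (suc (N ℕ.+ N)))
      jacobi = begin
        ε * (F x * (F x * F x))
          ≈⟨ solve 2 (λ e f → e :* (f :* (f :* f)) := f :* (f :* (e :* f))) refl ε (F x) ⟩
        F x * (F x * (ε * F x))
          ≈⟨ *-congˡ (*-congˡ (*-congˡ stable)) ⟨
        F x * (F x * (ε * P x (- x) n))
          ≈⟨ *-congˡ (*-congˡ (ε-P n (ε*-x εε'≈0))) ⟨
        F x * (F x * (ε * P x (x * b) n))
          ≈⟨ solve 4 (λ f g e h → f :* (g :* (e :* h)) := f :* ((e :* g) :* h)) refl (F x) (F x) ε _ ⟩
        F x * ((ε * F x) * P x (x * b) n)
          ≈⟨ *-congˡ (*-cong (trans (*-congˡ (sym stable)) (sym (ε-P n (ε*-x ε²≈0)))) (P-cong₂ n refl (*-comm x b))) ⟩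
        F x * ((ε * P x (x * a) n) * P x (b * x) n)
          ≈⟨ *-congˡ (solve 3 (λ e g h → (e :* g) :* h := g :* (e :* h)) refl ε _ _) ⟩
        F x * (P x (x * a) n * (ε * P x (b * x) n))
          -- Read backwards: the first factor of `P x b (suc n)` is 1 + b = ε, the zero of the
          -- product. It supplies the ε that allows the other factors to be simplified.
          ≈⟨ *-congˡ (*-congˡ (trans (Gauss.P-first x b n) (*-congʳ 1+b≈ε))) ⟨
        F x * (P x (x * a) n * P x b (suc n))
          ≈⟨ Gauss.triple-product x uv≈x {N} x^N≈0 (F⁻¹ x) (F⁻¹-inverse x^N≈0) (suc n) n (ℕ.m<n⇒m<1+n ℕ.≤-refl) ℕ.≤-refl ⟩
        Σ (p x (x * a)) (suc n) + Σ (p x b ∘ suc) (suc n)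
          ≈⟨ Σ-+ (p x (x * a)) (p x b ∘ suc) (suc n) ⟨
        Σ (λ k → p x (x * a) k + p x b (suc k)) (suc n)
          ≈⟨ Σ-cong (suc n) (λ k _ → term k) ⟩
        Σ (λ k → ε * jacobiTerm x k) (suc n)
          ≈⟨ Σ-*ˡ ε (jacobiTerm x) (suc n) ⟨
        ε * Σ (jacobiTerm x) (suc n) ∎
        where
        n = suc (N ℕ.+ N)
        stable : P x (- x) n ≈ F x
        stable = Gauss.P-stable x (- x) x^N≈0 (ℕ.≤-trans (ℕ.m≤m+n N N) (ℕ.n≤1+n _))
        uv≈x : (x * a) * b ≈ x
        uv≈x = trans (*-assoc x a b) (trans (*-congˡ ab≈1) (*-identityʳ x))
        term : ∀ k → p x (x * a) k + p x b (suc k) ≈ ε * jacobiTerm x k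
        term k = begin
          p x (x * a) k + p x b (suc k)
            ≈⟨ +-cong (Gauss.p-scale x x a k) (trans (p-cong x (suc k) (sym (*-identityˡ b))) (trans (Gauss.p-scale x 1# b (suc k)) (*-congʳ (p-one-suc x k)))) ⟩
          p x x k * a ^ k + p x x k * b ^ suc k
            ≈⟨ distribˡ _ _ _ ⟨
          p x x k * (a ^ k + b ^ suc k)
            ≈⟨ *-congˡ (power-sum k) ⟩
          p x x k * (ε * (n₁ ^ k * (1# + 2# * (k ×′ 1#))))
            ≈⟨ solve 3 (λ p e c → p :* (e :* c) := e :* (c :* p)) refl (p x x k) ε _ ⟩
          ε * jacobiTerm x k ∎

  -- Dissections along q, q^2, q^4, ...

  data Sign : Set where
    pos neg : Sign

  signed : Sign → Carrier → Carrier
  signed pos y = y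
  signed neg y = - y

  -- `X k` stands for q^(2^k), so that f_(2^k) is `f k` and the substitution q → q^2 is a shift of
  -- the index.
  module Chain (N : ℕ) (X : ℕ → Carrier) (X-suc : ∀ k → X (suc k) ≡ X k * X k)
               (X-nilpotent : ∀ k → X k ^ N ≈ 0#) where

    open Truncated N

    f ψ u : ℕ → Carrier
    f k = F (X k)
    ψ k = Ψ (X k)
    u k = f k ^ 7

    φ : Sign → ℕ → Carrier
    φ s k = Φ (signed s (X k))

    φ-neg-product : ∀ k → φ neg k * f (1 ℕ.+ k) ≈ f k ^ 2
    φ-neg-product k rewrite X-suc k =
      trans (Φ-negative (X-nilpotent k)) (*-congˡ (sym (*-identityʳ _)))

    φ-pos-product : ∀ k → φ pos k * (f k ^ 2 * f (2 ℕ.+ k) ^ 2) ≈ f (1 ℕ.+ k) ^ 5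
    φ-pos-product k rewrite X-suc (suc k) | X-suc k = trans
      (*-congˡ (*-cong (*-congˡ (*-identityʳ _)) (*-congˡ (*-identityʳ _)))) (Φ-positive (X-nilpotent k))

    ψ-product : ∀ k → ψ k * f k ≈ f (1 ℕ.+ k) ^ 2
    ψ-product k rewrite X-suc k = trans (Ψ-product (X k)) (*-congˡ (sym (*-identityʳ _)))

    φ-dissection : ∀ s k → φ s k ≈ φ pos (2 ℕ.+ k) + signed s (X k) * (2# * ψ (3 ℕ.+ k))
    φ-dissection s k rewrite X-suc (2 ℕ.+ k) | X-suc (1 ℕ.+ k) | X-suc k = dissect s
      where
      x = X k
      dissect : ∀ s → Φ (signed s x) ≈ Φ ((x * x) * (x * x)) + signed s x * (2# * Ψ (((x * x) * (x * x)) * ((x * x) * (x * x))))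
      dissect pos = Φ-dissection x (X-nilpotent k)
      dissect neg = trans (Φ-dissection (- x) (-‿nilpotent (X-nilpotent k)))
        (+-cong (Φ-cong x₄) (*-congˡ (*-congˡ (Ψ-cong (*-cong x₄ x₄)))))
        where x₄ = *-cong (square-neg x) (square-neg x)

    -- The two dissections of φ(± X k) multiply to a difference of squares. The index 1 + k is
    -- essential: X (1 + k) needs its square root X k.
    φ-neg-square : ∀ k → φ neg (1 ℕ.+ k) ^ 2 ≈ φ pos (2 ℕ.+ k) ^ 2 + - X (1 ℕ.+ k) * (2# * ψ (3 ℕ.+ k)) ^ 2
    φ-neg-square k = begin
      φ neg (1 ℕ.+ k) ^ 2
        ≈⟨ *-congˡ (*-identityʳ _) ⟩
      φ neg (1 ℕ.+ k) * φ neg (1 ℕ.+ k)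
        ≡⟨ ≡.cong (λ y → Φ (- y) * Φ (- y)) (X-suc k) ⟩
      Φ (- (X k * X k)) * Φ (- (X k * X k))
        ≈⟨ Φ-conjugate (X-nilpotent k) ⟨
      φ pos k * φ neg k
        ≈⟨ *-cong (φ-dissection pos k) (φ-dissection neg k) ⟩
      (a + X k * b) * (a + - X k * b)
        ≈⟨ solve 4 (λ a b x y → (a :+ x :* b) :* (a :+ y :* b) := a :^ 2 :+ ((x :+ y) :* (a :* b) :+ (x :* y) :* b :^ 2)) refl a b (X k) (- X k) ⟩
      a ^ 2 + ((X k + - X k) * (a * b) + (X k * - X k) * b ^ 2)
        ≈⟨ +-congˡ (trans (+-cong (trans (*-congʳ (-‿inverseʳ _)) (zeroˡ _)) (*-congʳ (*-neg-square (X k)))) (+-identityˡ _)) ⟩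
      a ^ 2 + - (X k * X k) * b ^ 2
        ≡⟨ ≡.cong (λ y → a ^ 2 + - y * b ^ 2) (X-suc k) ⟨
      a ^ 2 + - X (1 ℕ.+ k) * b ^ 2 ∎
      where
      a = φ pos (2 ℕ.+ k)
      b = 2# * ψ (3 ℕ.+ k)

    G Z V : Sign → ℕ → Carrier
    G s k = φ s k * f (1 ℕ.+ k) ^ 5
    Z s k = φ s k * f (3 ℕ.+ k) ^ 5
    V s k = φ s k * ((f (1 ℕ.+ k) ^ 2 * f (2 ℕ.+ k)) * f (3 ℕ.+ k) ^ 2)

    E : ℕ → Carrier
    E k = f k ^ 4 * f (1 ℕ.+ k) ^ 2

    dissect-product : ∀ s k g → φ s k * g ≈ φ pos (2 ℕ.+ k) * g + (signed s (X k) * 2#) * (ψ (3 ℕ.+ k) * g)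
    dissect-product s k g = trans (*-congʳ (φ-dissection s k))
      (solve 5 (λ a x t b g → (a :+ x :* (t :* b)) :* g := a :* g :+ (x :* t) :* (b :* g)) refl _ (signed s (X k)) 2# (ψ (3 ℕ.+ k)) g)

    -- For q = X k the two functions are f_2^5 f_8^5 / (f_4^2 f_16^2) and f_4^5 f_16^5 / (f_2^2
    -- f_8^2); their exponents agree modulo 7. `G-odd` and `V-even` arise in the same way, while
    -- `Z-odd` and `V-odd` need no seventh powers.
    G-even : ∀ k → (φ pos (2 ℕ.+ k) * f (1 ℕ.+ k) ^ 5) * (u (2 ℕ.+ k) * u (4 ℕ.+ k)) ≈ Z pos (1 ℕ.+ k) * (u (1 ℕ.+ k) * u (3 ℕ.+ k))
    G-even k = begin
      (φ pos (2 ℕ.+ k) * a ^ 5) * (b ^ 7 * d ^ 7)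
        ≈⟨ solve 4 (λ φ a b d → (φ :* a :^ 5) :* (b :^ 7 :* d :^ 7) := (φ :* (b :^ 2 :* d :^ 2)) :* ((a :^ 5 :* b :^ 5) :* d :^ 5)) refl (φ pos (2 ℕ.+ k)) a b d ⟩
      (φ pos (2 ℕ.+ k) * (b ^ 2 * d ^ 2)) * ((a ^ 5 * b ^ 5) * d ^ 5)
        ≈⟨ *-congʳ (φ-pos-product (2 ℕ.+ k)) ⟩
      c' ^ 5 * ((a ^ 5 * b ^ 5) * d ^ 5)
        ≈⟨ solve 4 (λ a b c d → c :* ((a :* b) :* d) := b :* ((a :* c) :* d)) refl (a ^ 5) (b ^ 5) (c' ^ 5) (d ^ 5) ⟩
      b ^ 5 * ((a ^ 5 * c' ^ 5) * d ^ 5)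
        ≈⟨ *-congʳ (φ-pos-product (1 ℕ.+ k)) ⟨
      (φ pos (1 ℕ.+ k) * (a ^ 2 * c' ^ 2)) * ((a ^ 5 * c' ^ 5) * d ^ 5)
        ≈⟨ solve 4 (λ φ a c d → (φ :* (a :^ 2 :* c :^ 2)) :* ((a :^ 5 :* c :^ 5) :* d :^ 5) := (φ :* d :^ 5) :* (a :^ 7 :* c :^ 7)) refl (φ pos (1 ℕ.+ k)) a c' d ⟩
      Z pos (1 ℕ.+ k) * (a ^ 7 * c' ^ 7) ∎
      where
      a = f (1 ℕ.+ k)
      b = f (2 ℕ.+ k)
      c' = f (3 ℕ.+ k)
      d = f (4 ℕ.+ k)

    G-odd : ∀ k → (ψ (3 ℕ.+ k) * f (1 ℕ.+ k) ^ 5) * u (2 ℕ.+ k) ≈ V pos (1 ℕ.+ k) * u (1 ℕ.+ k)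
    G-odd k = begin
      (s * a ^ 5) * b ^ 7
        ≈⟨ solve 3 (λ s a b → (s :* a :^ 5) :* b :^ 7 := b :^ 5 :* ((a :^ 5 :* b :^ 2) :* s)) refl s a b ⟩
      b ^ 5 * ((a ^ 5 * b ^ 2) * s)
        ≈⟨ *-congʳ (φ-pos-product (1 ℕ.+ k)) ⟨
      (φ⁺ * (a ^ 2 * c' ^ 2)) * ((a ^ 5 * b ^ 2) * s)
        ≈⟨ solve 5 (λ φ a b c s → (φ :* (a :^ 2 :* c :^ 2)) :* ((a :^ 5 :* b :^ 2) :* s)
             := (φ :* ((b :^ 2 :* c) :* (s :* c))) :* a :^ 7) refl φ⁺ a b c' s ⟩
      (φ⁺ * ((b ^ 2 * c') * (s * c'))) * a ^ 7
        ≈⟨ *-congʳ (*-congˡ (*-congˡ (ψ-product (3 ℕ.+ k)))) ⟩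
      V pos (1 ℕ.+ k) * a ^ 7 ∎
      where
      s = ψ (3 ℕ.+ k)
      φ⁺ = φ pos (1 ℕ.+ k)
      a = f (1 ℕ.+ k)
      b = f (2 ℕ.+ k)
      c' = f (3 ℕ.+ k)

    Z-odd : ∀ k → ψ k * f k ^ 5 ≈ E k
    Z-odd k = begin
      ψ k * f k ^ 5              ≈⟨ solve 2 (λ s c → s :* c :^ 5 := c :^ 4 :* (s :* c)) refl (ψ k) (f k) ⟩
      f k ^ 4 * (ψ k * f k)      ≈⟨ *-congˡ (ψ-product k) ⟩
      E k                        ∎

    V-even : ∀ k → (φ pos (2 ℕ.+ k) * ((f (1 ℕ.+ k) ^ 2 * f (2 ℕ.+ k)) * f (3 ℕ.+ k) ^ 2)) * u (4 ℕ.+ k)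
                 ≈ Z neg (1 ℕ.+ k) * u (3 ℕ.+ k)
    V-even k = begin
      (φ⁺ * ((f (1 ℕ.+ k) ^ 2 * b) * c' ^ 2)) * d ^ 7
        ≈⟨ *-congʳ (*-congˡ (*-congʳ (*-congʳ (φ-neg-product (1 ℕ.+ k))))) ⟨
      (φ⁺ * (((φ⁻ * b) * b) * c' ^ 2)) * d ^ 7
        ≈⟨ solve 5 (λ φ η b c d → (φ :* (((η :* b) :* b) :* c :^ 2)) :* d :^ 7
             := (φ :* (b :^ 2 :* d :^ 2)) :* (η :* (c :^ 2 :* d :^ 5))) refl φ⁺ φ⁻ b c' d ⟩
      (φ⁺ * (b ^ 2 * d ^ 2)) * (φ⁻ * (c' ^ 2 * d ^ 5))
        ≈⟨ *-congʳ (φ-pos-product (2 ℕ.+ k)) ⟩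
      c' ^ 5 * (φ⁻ * (c' ^ 2 * d ^ 5))
        ≈⟨ solve 3 (λ η c d → c :^ 5 :* (η :* (c :^ 2 :* d :^ 5)) := (η :* d :^ 5) :* c :^ 7) refl φ⁻ c' d ⟩
      Z neg (1 ℕ.+ k) * c' ^ 7 ∎
      where
      φ⁺ = φ pos (2 ℕ.+ k)
      φ⁻ = φ neg (1 ℕ.+ k)
      b = f (2 ℕ.+ k)
      c' = f (3 ℕ.+ k)
      d = f (4 ℕ.+ k)

    V-odd : ∀ k → ψ (3 ℕ.+ k) * ((f (1 ℕ.+ k) ^ 2 * f (2 ℕ.+ k)) * f (3 ℕ.+ k) ^ 2) ≈ V neg (1 ℕ.+ k)
    V-odd k = begin
      s * ((f (1 ℕ.+ k) ^ 2 * b) * c' ^ 2)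
        ≈⟨ *-congˡ (*-congʳ (*-congʳ (φ-neg-product (1 ℕ.+ k)))) ⟨
      s * (((φ⁻ * b) * b) * c' ^ 2)
        ≈⟨ solve 4 (λ s η b c → s :* (((η :* b) :* b) :* c :^ 2) := η :* ((b :^ 2 :* c) :* (s :* c))) refl s φ⁻ b c' ⟩
      φ⁻ * ((b ^ 2 * c') * (s * c'))
        ≈⟨ *-congˡ (*-congˡ (ψ-product (3 ℕ.+ k))) ⟩
      V neg (1 ℕ.+ k) ∎
      where
      s = ψ (3 ℕ.+ k)
      φ⁻ = φ neg (1 ℕ.+ k)
      b = f (2 ℕ.+ k)
      c' = f (3 ℕ.+ k)

    φ-neg-f : ∀ k → G neg k ≈ f k ^ 2 * f (1 ℕ.+ k) ^ 4
    φ-neg-f k = trans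
      (solve 2 (λ η b → η :* b :^ 5 := (η :* b) :* b :^ 4) refl (φ neg k) (f (1 ℕ.+ k)))
      (*-congʳ (φ-neg-product k))

    -- The dissection of φ(-q)^2 is used twice, for f_1^4 = φ(-q)^2 f_2^2 and then, in the odd part,
    -- for f_2^4 = φ(-q^2)^2 f_4^2. The factors ψ are absorbed by ψ(q) f_1 = f_2^2.
    E-expansion : ∀ k → let j = 1 ℕ.+ k in
      E j ≈ φ pos (1 ℕ.+ j) ^ 2 * f (1 ℕ.+ j) ^ 4
            + (- X j * 2# ^ 2) * (φ pos (2 ℕ.+ j) ^ 2 * f (3 ℕ.+ j) ^ 4 + (- X (1 ℕ.+ j) * 2# ^ 2) * G neg (3 ℕ.+ j))
    E-expansion k = begin
      f j ^ 4 * a ^ 2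
        ≈⟨ fourth-power j (a ^ 2) ⟩
      (φ neg j ^ 2 * a ^ 2) * a ^ 2
        ≈⟨ *-congʳ (*-congʳ (φ-neg-square k)) ⟩
      ((φ pos (1 ℕ.+ j) ^ 2 + - X j * (2# * s) ^ 2) * a ^ 2) * a ^ 2
        ≈⟨ solve 5 (λ φ x t s a → ((φ :^ 2 :+ x :* (t :* s) :^ 2) :* a :^ 2) :* a :^ 2
             := φ :^ 2 :* a :^ 4 :+ (x :* t :^ 2) :* (a :^ 4 :* s :^ 2)) refl (φ pos (1 ℕ.+ j)) (- X j) 2# s a ⟩
      φ pos (1 ℕ.+ j) ^ 2 * a ^ 4 + (- X j * 2# ^ 2) * (a ^ 4 * s ^ 2)
        ≈⟨ +-congˡ (*-congˡ second) ⟩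
      φ pos (1 ℕ.+ j) ^ 2 * a ^ 4
        + (- X j * 2# ^ 2) * (φ pos (2 ℕ.+ j) ^ 2 * c' ^ 4 + (- X (1 ℕ.+ j) * 2# ^ 2) * G neg (3 ℕ.+ j)) ∎
      where
      j = 1 ℕ.+ k
      s = ψ (2 ℕ.+ j)
      t = ψ (3 ℕ.+ j)
      a = f (1 ℕ.+ j)
      b = f (2 ℕ.+ j)
      c' = f (3 ℕ.+ j)
      d = f (4 ℕ.+ j)
      fourth-power : ∀ i g → f i ^ 4 * g ≈ (φ neg i ^ 2 * f (1 ℕ.+ i) ^ 2) * g
      fourth-power i g = *-congʳ (begin
        f i ^ 4                             ≈⟨ solve 1 (λ f → f :^ 4 := f :^ 2 :* f :^ 2) refl (f i) ⟩
        f i ^ 2 * f i ^ 2                   ≈⟨ *-cong (φ-neg-product i) (φ-neg-product i) ⟨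
        (φ neg i * f (1 ℕ.+ i)) * (φ neg i * f (1 ℕ.+ i))
          ≈⟨ solve 2 (λ η f → (η :* f) :* (η :* f) := η :^ 2 :* f :^ 2) refl (φ neg i) (f (1 ℕ.+ i)) ⟩
        φ neg i ^ 2 * f (1 ℕ.+ i) ^ 2       ∎)
      last : c' ^ 4 * t ^ 2 ≈ G neg (3 ℕ.+ j)
      last = begin
        c' ^ 4 * t ^ 2               ≈⟨ solve 2 (λ c t → c :^ 4 :* t :^ 2 := c :^ 2 :* (t :* c) :^ 2) refl c' t ⟩
        c' ^ 2 * (t * c') ^ 2        ≈⟨ *-congˡ (^-congˡ 2 (ψ-product (3 ℕ.+ j))) ⟩
        c' ^ 2 * (d ^ 2) ^ 2         ≈⟨ *-congˡ (^-assocʳ d 2 2) ⟩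
        c' ^ 2 * d ^ 4               ≈⟨ φ-neg-f (3 ℕ.+ j) ⟨
        G neg (3 ℕ.+ j)              ∎
      second : a ^ 4 * s ^ 2 ≈ φ pos (2 ℕ.+ j) ^ 2 * c' ^ 4 + (- X (1 ℕ.+ j) * 2# ^ 2) * G neg (3 ℕ.+ j)
      second = begin
        a ^ 4 * s ^ 2
          ≈⟨ fourth-power (1 ℕ.+ j) (s ^ 2) ⟩
        (φ neg (1 ℕ.+ j) ^ 2 * b ^ 2) * s ^ 2
          ≈⟨ solve 3 (λ η b s → (η :* b :^ 2) :* s :^ 2 := η :* (s :* b) :^ 2) refl (φ neg (1 ℕ.+ j) ^ 2) b s ⟩
        φ neg (1 ℕ.+ j) ^ 2 * (s * b) ^ 2
          ≈⟨ *-cong (φ-neg-square j) (trans (^-congˡ 2 (ψ-product (2 ℕ.+ j))) (^-assocʳ c' 2 2)) ⟩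
        (φ pos (2 ℕ.+ j) ^ 2 + - X (1 ℕ.+ j) * (2# * t) ^ 2) * c' ^ 4
          ≈⟨ solve 5 (λ φ x two t c → (φ :+ x :* (two :* t) :^ 2) :* c :^ 4
               := φ :* c :^ 4 :+ (x :* two :^ 2) :* (c :^ 4 :* t :^ 2)) refl (φ pos (2 ℕ.+ j) ^ 2) (- X (1 ℕ.+ j)) 2# t c' ⟩
        φ pos (2 ℕ.+ j) ^ 2 * c' ^ 4 + (- X (1 ℕ.+ j) * 2# ^ 2) * (c' ^ 4 * t ^ 2)
          ≈⟨ +-congˡ (*-congˡ last) ⟩
        φ pos (2 ℕ.+ j) ^ 2 * c' ^ 4 + (- X (1 ℕ.+ j) * 2# ^ 2) * G neg (3 ℕ.+ j) ∎

    -- The left function is f_2^10 / f_4^4 and that of `E-odd` is f_2^14 / (f_1^4 f_4^4). Since 10 ≡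
    -- -4 ≡ 3 and 14 ≡ 0 modulo 7, each is a product of two cubes up to seventh powers.
    E-even : ∀ k → (φ pos k ^ 2 * f k ^ 4) * u (2 ℕ.+ k) ≈ (f (1 ℕ.+ k) ^ 3 * f (2 ℕ.+ k) ^ 3) * u (1 ℕ.+ k)
    E-even k = begin
      (φ pos k ^ 2 * a ^ 4) * c' ^ 7
        ≈⟨ solve 3 (λ φ a c → (φ :^ 2 :* a :^ 4) :* c :^ 7 := (φ :* (a :^ 2 :* c :^ 2)) :^ 2 :* c :^ 3) refl (φ pos k) a c' ⟩
      (φ pos k * (a ^ 2 * c' ^ 2)) ^ 2 * c' ^ 3
        ≈⟨ *-congʳ (^-congˡ 2 (φ-pos-product k)) ⟩
      (b ^ 5) ^ 2 * c' ^ 3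
        ≈⟨ solve 2 (λ b c → (b :^ 5) :^ 2 :* c :^ 3 := (b :^ 3 :* c :^ 3) :* b :^ 7) refl b c' ⟩
      (b ^ 3 * c' ^ 3) * b ^ 7 ∎
      where
      a = f k
      b = f (1 ℕ.+ k)
      c' = f (2 ℕ.+ k)

    E-odd : ∀ k → (φ pos k ^ 2 * f (1 ℕ.+ k) ^ 4) * (u k * u (2 ℕ.+ k)) ≈ (f k ^ 3 * f (2 ℕ.+ k) ^ 3) * (u (1 ℕ.+ k) * u (1 ℕ.+ k))
    E-odd k = begin
      (φ pos k ^ 2 * b ^ 4) * (a ^ 7 * c' ^ 7)
        ≈⟨ solve 4 (λ φ a b c → (φ :^ 2 :* b :^ 4) :* (a :^ 7 :* c :^ 7) := (φ :* (a :^ 2 :* c :^ 2)) :^ 2 :* ((a :^ 3 :* c :^ 3) :* b :^ 4)) refl (φ pos k) a b c' ⟩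
      (φ pos k * (a ^ 2 * c' ^ 2)) ^ 2 * ((a ^ 3 * c' ^ 3) * b ^ 4)
        ≈⟨ *-congʳ (^-congˡ 2 (φ-pos-product k)) ⟩
      (b ^ 5) ^ 2 * ((a ^ 3 * c' ^ 3) * b ^ 4)
        ≈⟨ solve 2 (λ b g → (b :^ 5) :^ 2 :* (g :* b :^ 4) := g :* (b :^ 7 :* b :^ 7)) refl b (a ^ 3 * c' ^ 3) ⟩
      (a ^ 3 * c' ^ 3) * (b ^ 7 * b ^ 7) ∎
      where
      a = f k
      b = f (1 ℕ.+ k)
      c' = f (2 ℕ.+ k)

-- Truncated power series modulo 7

module _ where

  open import Data.Nat.Base using (_+_; _*_)
  open import Relation.Binary.PropositionalEquality

  infix 4 _≡₇_

  record _≡₇_ (m n : ℕ) : Set where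
    constructor mod₇
    field remainders : m % 7 ≡ n % 7

  open _≡₇_

  ≡₇-refl : ∀ {m} → m ≡₇ m
  ≡₇-refl = mod₇ refl

  ≡₇-sym : ∀ {m n} → m ≡₇ n → n ≡₇ m
  ≡₇-sym (mod₇ e) = mod₇ (sym e)

  ≡₇-trans : ∀ {m n o} → m ≡₇ n → n ≡₇ o → m ≡₇ o
  ≡₇-trans (mod₇ e) (mod₇ e') = mod₇ (trans e e')

  ≡⇒≡₇ : ∀ {m n} → m ≡ n → m ≡₇ n
  ≡⇒≡₇ e = mod₇ (cong (_% 7) e)

  +-cong₇ : ∀ {a b c d} → a ≡₇ b → c ≡₇ d → a + c ≡₇ b + d
  +-cong₇ {a} {b} {c} {d} (mod₇ p) (mod₇ r) = mod₇ (begin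
    (a + c) % 7          ≡⟨ %-distribˡ-+ a c 7 ⟩
    (a % 7 + c % 7) % 7  ≡⟨ cong₂ (λ x y → (x + y) % 7) p r ⟩
    (b % 7 + d % 7) % 7  ≡⟨ %-distribˡ-+ b d 7 ⟨
    (b + d) % 7          ∎)
    where open ≡-Reasoning

  *-cong₇ : ∀ {a b c d} → a ≡₇ b → c ≡₇ d → a * c ≡₇ b * d
  *-cong₇ {a} {b} {c} {d} (mod₇ p) (mod₇ r) = mod₇ (begin
    (a * c) % 7              ≡⟨ %-distribˡ-* a c 7 ⟩
    ((a % 7) * (c % 7)) % 7  ≡⟨ cong₂ (λ x y → (x * y) % 7) p r ⟩
    ((b % 7) * (d % 7)) % 7  ≡⟨ %-distribˡ-* b d 7 ⟨
    (b * d) % 7              ∎)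
    where open ≡-Reasoning

  ≡₇-drop : ∀ {a} b c → a ≡ b + c * 7 → a ≡₇ b
  ≡₇-drop b c refl = mod₇ ([m+kn]%n≡m%n b c 7)

  -- Adding 6a to a + b leaves b + 7a, so 6a takes the place of -a.
  ≡₇-cancelˡ-+ : ∀ {a a' b b'} → a ≡₇ a' → a + b ≡₇ a' + b' → b ≡₇ b'
  ≡₇-cancelˡ-+ {a} {a'} {b} {b'} p r =
    ≡₇-trans (≡₇-sym (≡₇-drop b a (eq a b)))
      (≡₇-trans (+-cong₇ (*-cong₇ (≡₇-refl {6}) p) r) (≡₇-drop b' a' (eq a' b')))
    where
    open +-*-Solver
    eq : ∀ a b → 6 * a + (a + b) ≡ b + a * 7
    eq = solve 2 (λ a b → con 6 :* a :+ (a :+ b) := b :+ a :* con 7) refl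

  -- The ring of power series

  Series : Set
  Series = ℕ → ℕ

  infixl 6 _⊕_
  infixl 7 _⊛_

  -- The Cauchy product follows the decomposition f = f 0 + q (f ∘ suc), which turns the ring laws
  -- into inductions on the exponent.
  _⊕_ _⊛_ : Series → Series → Series
  (f ⊕ g) n = f n + g n
  (f ⊛ g) zero    = f 0 * g 0
  (f ⊛ g) (suc n) = f 0 * g (suc n) + ((f ∘ suc) ⊛ g) n

  -- Coefficients only matter modulo 7, so that 6 serves as -1.
  ⊝_ : Series → Series
  (⊝ f) n = 6 * f n

  𝟘 𝟙 q : Series
  𝟘 n = 0
  𝟙 zero    = 1
  𝟙 (suc n) = 0
  q zero    = 0
  q (suc n) = 𝟙 n

  module _ where
    open ≡-Reasoning
    open +-*-Solver

    ⊛-distribʳ : ∀ h f g n → ((f ⊕ g) ⊛ h) n ≡ (f ⊛ h) n + (g ⊛ h) n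
    ⊛-distribʳ h f g zero    = ℕ.*-distribʳ-+ (h 0) (f 0) (g 0)
    ⊛-distribʳ h f g (suc n) = trans (cong ((f 0 + g 0) * h (suc n) +_) (⊛-distribʳ h (f ∘ suc) (g ∘ suc) n))
      (solve 5 (λ a b c d e → (a :+ b) :* c :+ (d :+ e) := (a :* c :+ d) :+ (b :* c :+ e)) refl (f 0) (g 0) (h (suc n)) _ _)

    ⊛-scaleˡ : ∀ a f g n → ((λ i → a * f i) ⊛ g) n ≡ a * (f ⊛ g) n
    ⊛-scaleˡ a f g zero    = ℕ.*-assoc a (f 0) (g 0)
    ⊛-scaleˡ a f g (suc n) = trans (cong ((a * f 0) * g (suc n) +_) (⊛-scaleˡ a (f ∘ suc) g n))
      (solve 4 (λ a b c d → (a :* b) :* c :+ a :* d := a :* (b :* c :+ d)) refl a (f 0) (g (suc n)) _)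

    ⊛-assoc : ∀ f g h n → ((f ⊛ g) ⊛ h) n ≡ (f ⊛ (g ⊛ h)) n
    ⊛-assoc f g h zero    = ℕ.*-assoc (f 0) (g 0) (h 0)
    ⊛-assoc f g h (suc n) = begin
      (f 0 * g 0) * h (suc n) + (((λ i → f 0 * g (suc i)) ⊕ ((f ∘ suc) ⊛ g)) ⊛ h) n
        ≡⟨ cong ((f 0 * g 0) * h (suc n) +_) (trans (⊛-distribʳ h (λ i → f 0 * g (suc i)) ((f ∘ suc) ⊛ g) n)
             (cong₂ _+_ (⊛-scaleˡ (f 0) (g ∘ suc) h n) (⊛-assoc (f ∘ suc) g h n))) ⟩
      (f 0 * g 0) * h (suc n) + (f 0 * ((g ∘ suc) ⊛ h) n + ((f ∘ suc) ⊛ (g ⊛ h)) n)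
        ≡⟨ solve 5 (λ a b c d e → (a :* b) :* c :+ (a :* d :+ e) := a :* (b :* c :+ d) :+ e) refl (f 0) (g 0) (h (suc n)) _ _ ⟩
      (f ⊛ (g ⊛ h)) (suc n) ∎

    ⊛-sucʳ : ∀ f g n → (f ⊛ g) (suc n) ≡ (f ⊛ (g ∘ suc)) n + f (suc n) * g 0
    ⊛-sucʳ f g zero    = refl
    ⊛-sucʳ f g (suc n) = trans (cong (f 0 * g (suc (suc n)) +_) (⊛-sucʳ (f ∘ suc) g n)) (sym (ℕ.+-assoc (f 0 * g (suc (suc n))) _ _))

    ⊛-comm : ∀ f g n → (f ⊛ g) n ≡ (g ⊛ f) n
    ⊛-comm f g zero    = ℕ.*-comm (f 0) (g 0)
    ⊛-comm f g (suc n) = begin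
      f 0 * g (suc n) + ((f ∘ suc) ⊛ g) n  ≡⟨ cong₂ _+_ (ℕ.*-comm (f 0) _) (⊛-comm (f ∘ suc) g n) ⟩
      g (suc n) * f 0 + (g ⊛ (f ∘ suc)) n  ≡⟨ ℕ.+-comm (g (suc n) * f 0) _ ⟩
      (g ⊛ (f ∘ suc)) n + g (suc n) * f 0  ≡⟨ ⊛-sucʳ g f n ⟨
      (g ⊛ f) (suc n)                      ∎

    ⊛-zeroˡ : ∀ f n → (𝟘 ⊛ f) n ≡ 0
    ⊛-zeroˡ f zero    = refl
    ⊛-zeroˡ f (suc n) = ⊛-zeroˡ f n

    ⊛-identityˡ : ∀ f n → (𝟙 ⊛ f) n ≡ f n
    ⊛-identityˡ f zero    = ℕ.*-identityˡ (f 0)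
    ⊛-identityˡ f (suc n) = trans (cong₂ _+_ (ℕ.*-identityˡ (f (suc n))) (⊛-zeroˡ f n)) (ℕ.+-identityʳ _)

  ⊛-cong₇ : ∀ {f f' g g'} n → (∀ i → i ≤ n → f i ≡₇ f' i) → (∀ i → i ≤ n → g i ≡₇ g' i) → (f ⊛ g) n ≡₇ (f' ⊛ g') n
  ⊛-cong₇ zero    e e' = *-cong₇ (e 0 z≤n) (e' 0 z≤n)
  ⊛-cong₇ (suc n) e e' = +-cong₇
    (*-cong₇ (e 0 z≤n) (e' (suc n) ℕ.≤-refl))
    (⊛-cong₇ n (λ i i≤n → e (suc i) (s≤s i≤n)) (λ i i≤n → e' i (ℕ.m≤n⇒m≤1+n i≤n)))

  record Agree (M : ℕ) (f g : Series) : Set where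
    constructor agree
    field coeff : ∀ n → n < M → f n ≡₇ g n

  open Agree

  ≗⇒Agree : ∀ {M f g} → (∀ n → f n ≡ g n) → Agree M f g
  ≗⇒Agree e = agree (λ n _ → ≡⇒≡₇ (e n))

  -- Power series over ℤ/7 modulo q^M.
  seriesRing : ℕ → CommutativeRing 0ℓ 0ℓ
  seriesRing M = record
    { Carrier = Series
    ; _≈_ = Agree M
    ; _+_ = _⊕_
    ; _*_ = _⊛_
    ; -_ = ⊝_
    ; 0# = 𝟘
    ; 1# = 𝟙
    ; isCommutativeRing = record
      { isRing = record
        { +-isAbelianGroup = record
          { isGroup = record
            { isMonoid = record
              { isSemigroup = record
                { isMagma = record
                  { isEquivalence = record
                    { refl = agree (λ n _ → ≡₇-refl)
                    ; sym = λ e → agree (λ n n<M → ≡₇-sym (coeff e n n<M))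
                    ; trans = λ e e' → agree (λ n n<M → ≡₇-trans (coeff e n n<M) (coeff e' n n<M))
                    }
                  ; ∙-cong = λ e e' → agree (λ n n<M → +-cong₇ (coeff e n n<M) (coeff e' n n<M))
                  }
                ; assoc = λ f g h → ≗⇒Agree (λ n → ℕ.+-assoc (f n) (g n) (h n))
                }
              ; identity = (λ f → ≗⇒Agree (λ n → refl)) , (λ f → ≗⇒Agree (λ n → ℕ.+-identityʳ (f n)))
              }
            ; inverse = (λ f → agree (λ n _ → ≡₇-trans (≡⇒≡₇ (ℕ.+-comm (6 * f n) (f n))) (inverse (f n))))
                      , (λ f → agree (λ n _ → inverse (f n)))
            ; ⁻¹-cong = λ e → agree (λ n n<M → *-cong₇ (≡₇-refl {6}) (coeff e n n<M))
            }
          ; comm = λ f g → ≗⇒Agree (λ n → ℕ.+-comm (f n) (g n))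
          }
        ; *-cong = λ e e' → agree (λ n n<M → ⊛-cong₇ n (λ i i≤n → coeff e i (ℕ.≤-<-trans i≤n n<M))
                                                      (λ i i≤n → coeff e' i (ℕ.≤-<-trans i≤n n<M)))
        ; *-assoc = λ f g h → ≗⇒Agree (⊛-assoc f g h)
        ; *-identity = (λ f → ≗⇒Agree (⊛-identityˡ f))
                     , (λ f → ≗⇒Agree (λ n → trans (⊛-comm f 𝟙 n) (⊛-identityˡ f n)))
        ; distrib = (λ f g h → ≗⇒Agree (λ n → trans (⊛-comm f (g ⊕ h) n)
                      (trans (⊛-distribʳ f g h n) (cong₂ _+_ (⊛-comm g f n) (⊛-comm h f n)))))
                  , (λ f g h → ≗⇒Agree (⊛-distribʳ f g h))
        }
      ; *-comm = λ f g → ≗⇒Agree (⊛-comm f g)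
      }
    }
    where
    inverse : ∀ a → a + 6 * a ≡₇ 0
    inverse a = ≡₇-drop 0 a (solve 1 (λ a → a :+ con 6 :* a := a :* con 7) refl a)
      where open +-*-Solver

  -- Supports of series

  -- Constructive form of "below b, the support modulo 7 lies in P": each exponent comes with a
  -- decision between the two alternatives.
  record Supp (b : ℕ) (P : ℕ → Set) (f : Series) : Set where
    constructor supp
    field at : ∀ i → i < b → P i ⊎ f i ≡₇ 0

  open Supp

  ⊛-Supp : ∀ {b P Q S f g} → Supp b P f → Supp b Q g → (∀ i j → P i → Q j → S (i + j)) → Supp b S (f ⊛ g)
  ⊛-Supp {b} {P} {Q} {S} {f} {g} Pf Qg imp = supp (λ n n<b →
    go n f P (λ i i≤n → at Pf i (ℕ.≤-<-trans i≤n n<b)) (λ j j≤n → at Qg j (ℕ.≤-<-trans j≤n n<b))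
      (λ i j i+j≡n p r → subst S i+j≡n (imp i j p r)))
    where
    vanish : ∀ f₀ g₀ {T A B : Set} → A ⊎ f₀ ≡₇ 0 → B ⊎ g₀ ≡₇ 0 → (A → B → T) → T ⊎ f₀ * g₀ ≡₇ 0
    vanish f₀ g₀ (inj₁ x) (inj₁ y) t = inj₁ (t x y)
    vanish f₀ g₀ (inj₂ e) _        t = inj₂ (*-cong₇ e (≡₇-refl {g₀}))
    vanish f₀ g₀ (inj₁ _) (inj₂ e) t = inj₂ (≡₇-trans (*-cong₇ (≡₇-refl {f₀}) e) (≡⇒≡₇ (ℕ.*-zeroʳ f₀)))
    -- P varies with f because the recursion of `⊛` shifts the left factor; T is the goal at the
    -- fixed total exponent.
    go : ∀ n (f : Series) (P : ℕ → Set) {T : Set} → (∀ i → i ≤ n → P i ⊎ f i ≡₇ 0) → (∀ j → j ≤ n → Q j ⊎ g j ≡₇ 0) →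
         (∀ i j → i + j ≡ n → P i → Q j → T) → T ⊎ (f ⊛ g) n ≡₇ 0
    go zero    f P pf qg t = vanish (f 0) (g 0) (pf 0 z≤n) (qg 0 z≤n) (t 0 0 refl)
    go (suc n) f P pf qg t
      with vanish (f 0) (g (suc n)) (pf 0 z≤n) (qg (suc n) ℕ.≤-refl) (t 0 (suc n) refl)
         | go n (f ∘ suc) (P ∘ suc) (λ i i≤n → pf (suc i) (s≤s i≤n)) (λ j j≤n → qg j (ℕ.m≤n⇒m≤1+n j≤n)) (λ i j e → t (suc i) j (cong suc e))
    ... | inj₁ x | _       = inj₁ x
    ... | inj₂ _ | inj₁ x  = inj₁ x
    ... | inj₂ e | inj₂ e' = inj₂ (+-cong₇ e e')

  Supp-map : ∀ {b P Q f g} → (∀ i → P i → Q i) → (∀ i → i < b → f i ≡₇ 0 → g i ≡₇ 0) → Supp b P f → Supp b Q g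
  Supp-map imp imp' Pf = supp (λ i i<b → Sum.map (imp i) (imp' i i<b) (at Pf i i<b))

  ⊕-Supp : ∀ {b P f g} → Supp b P f → Supp b P g → Supp b P (f ⊕ g)
  ⊕-Supp {b} {P} {f} {g} Pf Pg = supp coefficients
    where
    coefficients : ∀ i → i < b → P i ⊎ f i + g i ≡₇ 0
    coefficients i i<b with at Pf i i<b | at Pg i i<b
    ... | inj₁ x | _       = inj₁ x
    ... | inj₂ _ | inj₁ x  = inj₁ x
    ... | inj₂ e | inj₂ e' = inj₂ (+-cong₇ e e')

  ⊝-Supp : ∀ {b P f} → Supp b P f → Supp b P (⊝ f)
  ⊝-Supp = Supp-map (λ _ x → x) (λ _ _ e → *-cong₇ (≡₇-refl {6}) e)

  Supp-weaken : ∀ {b P Q f} → (∀ i → P i → Q i) → Supp b P f → Supp b Q f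
  Supp-weaken imp = Supp-map imp (λ _ _ e → e)

  𝟙-Supp : ∀ {b P} → P 0 → Supp b P 𝟙
  𝟙-Supp P0 = supp (λ { zero _ → inj₁ P0 ; (suc i) _ → inj₂ ≡₇-refl })

  q-Supp : ∀ {b P} → P 1 → Supp b P q
  q-Supp P1 = supp (λ { zero _ → inj₂ ≡₇-refl ; (suc zero) _ → inj₁ P1 ; (suc (suc i)) _ → inj₂ ≡₇-refl })

-- Residue classes of exponents, and the descent

degree : ℕ → ℕ
degree zero    = 1
degree (suc k) = 2 ℕ.* degree k

-- Built from 4, the inverse of 2 modulo 7.
degree⁻¹ : ℕ → ℕ
degree⁻¹ zero    = 1
degree⁻¹ (suc k) = 4 ℕ.* degree⁻¹ k

degree-inverse : ∀ k → degree⁻¹ k ℕ.* degree k ≡₇ 1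
degree-inverse zero    = ≡₇-refl
degree-inverse (suc k) = ≡₇-trans
  (≡₇-drop (e ℕ.* d) (e ℕ.* d) (solve 2 (λ e d → (con 4 :* e) :* (con 2 :* d) := e :* d :+ (e :* d) :* con 7) ≡.refl e d))
  (degree-inverse k)
  where
  open +-*-Solver
  e = degree⁻¹ k
  d = degree k

degree-cancel : ∀ k {a b} → degree k ℕ.* a ≡₇ degree k ℕ.* b → a ≡₇ b
degree-cancel k {a} {b} eq = ≡₇-trans (≡₇-sym (undo a)) (≡₇-trans (*-cong₇ (≡₇-refl {e}) eq) (undo b))
  where
  e = degree⁻¹ k
  d = degree k
  undo : ∀ a → e ℕ.* (d ℕ.* a) ≡₇ a
  undo a = ≡₇-trans (≡⇒≡₇ (≡.sym (ℕ.*-assoc e d a)))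
    (≡₇-trans (*-cong₇ (degree-inverse k) ≡₇-refl) (≡⇒≡₇ (ℕ.*-identityˡ a)))

degree-positive : ∀ k → 1 ≤ degree k
degree-positive zero    = s≤s z≤n
degree-positive (suc k) = ℕ.≤-trans (degree-positive k) (ℕ.m≤m+n _ _)

degree-unbounded : ∀ k → k < degree k
degree-unbounded zero    = s≤s z≤n
degree-unbounded (suc k) = ℕ.≤-trans (ℕ.+-mono-≤ (degree-positive k) (degree-unbounded k))
  (ℕ.+-monoʳ-≤ (degree k) (ℕ.≤-reflexive (≡.sym (ℕ.+-identityʳ _))))

-- The residues mod 7 of the triangular numbers n(n+1)/2 with 7 ∤ 2n+1.
data Tri : ℕ → Set where
  tri₀ : Tri 0
  tri₁ : Tri 1
  tri₃ : Tri 3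

triangular : ℕ → ℕ
triangular zero    = 0
triangular (suc k) = triangular k ℕ.+ suc k

-- As 8 ≡ 1, `Tri s` says that s + 1 is a nonzero square modulo 7, namely 1, 2 or 4. For c = 1, 2, 4
-- the excluded r is -1 - c, so equality would give x^2 + c y^2 ≡ 0 with x and y nonzero. But c is a
-- square and -1 is not one modulo 7. The same holds for `tri-1-2` and `tri-1-4`.
tri-1-1 : ∀ {s t} → Tri s → Tri t → ¬ (s ℕ.+ 1 ℕ.* t ≡₇ 5)
tri-1-1 tri₀ tri₀ (mod₇ ())
tri-1-1 tri₀ tri₁ (mod₇ ())
tri-1-1 tri₀ tri₃ (mod₇ ())
tri-1-1 tri₁ tri₀ (mod₇ ())
tri-1-1 tri₁ tri₁ (mod₇ ())
tri-1-1 tri₁ tri₃ (mod₇ ())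
tri-1-1 tri₃ tri₀ (mod₇ ())
tri-1-1 tri₃ tri₁ (mod₇ ())
tri-1-1 tri₃ tri₃ (mod₇ ())

tri-1-2 : ∀ {s t} → Tri s → Tri t → ¬ (s ℕ.+ 2 ℕ.* t ≡₇ 4)
tri-1-2 tri₀ tri₀ (mod₇ ())
tri-1-2 tri₀ tri₁ (mod₇ ())
tri-1-2 tri₀ tri₃ (mod₇ ())
tri-1-2 tri₁ tri₀ (mod₇ ())
tri-1-2 tri₁ tri₁ (mod₇ ())
tri-1-2 tri₁ tri₃ (mod₇ ())
tri-1-2 tri₃ tri₀ (mod₇ ())
tri-1-2 tri₃ tri₁ (mod₇ ())
tri-1-2 tri₃ tri₃ (mod₇ ())

tri-1-4 : ∀ {s t} → Tri s → Tri t → ¬ (s ℕ.+ 4 ℕ.* t ≡₇ 2)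
tri-1-4 tri₀ tri₀ (mod₇ ())
tri-1-4 tri₀ tri₁ (mod₇ ())
tri-1-4 tri₀ tri₃ (mod₇ ())
tri-1-4 tri₁ tri₀ (mod₇ ())
tri-1-4 tri₁ tri₁ (mod₇ ())
tri-1-4 tri₁ tri₃ (mod₇ ())
tri-1-4 tri₃ tri₀ (mod₇ ())
tri-1-4 tri₃ tri₁ (mod₇ ())
tri-1-4 tri₃ tri₃ (mod₇ ())

-- Homogeneous series, and classes of exponents that a series avoids

module Truncation (N₀ : ℕ) where

  -- Ring identities hold modulo q^M, supports are claimed only below N₀: the other half of the
  -- precision is spent on the factor q^N₀ in Jacobi's identity.
  M : ℕ
  M = N₀ ℕ.+ N₀

  R : CommutativeRing 0ℓ 0ℓ
  R = seriesRing M

  open CommutativeRing R hiding (zero)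
  open import Algebra.Properties.CommutativeSemiring.Exp commutativeSemiring
  open import Algebra.Properties.Semiring.Mult semiring using () renaming (_×_ to _×′_)
  open FormalTheta R
  open Truncated M
  open import Relation.Binary.Reasoning.Setoid setoid

  N₀≤M : N₀ ≤ M
  N₀≤M = ℕ.m≤m+n N₀ N₀

  Supp-≈ : ∀ {P f g} → f ≈ g → Supp N₀ P f → Supp N₀ P g
  Supp-≈ f≈g = Supp-map (λ _ x → x) (λ i i<N e → ≡₇-trans (≡₇-sym (Agree.coeff f≈g i (ℕ.<-≤-trans i<N N₀≤M))) e)

  Homog Avoid : ℕ → Series → Set
  Homog d = Supp N₀ (_≡₇ d)
  Avoid r = Supp N₀ (λ i → ¬ (i ≡₇ r))

  Homog-* : ∀ {d e f g} → Homog d f → Homog e g → Homog (d ℕ.+ e) (f * g)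
  Homog-* {d} {e} hf hg = ⊛-Supp hf hg (λ i j → +-cong₇)

  Homog-mod : ∀ {d e f} → d ≡₇ e → Homog d f → Homog e f
  Homog-mod d≡e = Supp-weaken (λ i p → ≡₇-trans p d≡e)

  Homog-^ : ∀ {d f} n → Homog d f → Homog (n ℕ.* d) (f ^ n)
  Homog-^ zero    hf = 𝟙-Supp ≡₇-refl
  Homog-^ (suc n) hf = Homog-* hf (Homog-^ n hf)

  Avoid-mod : ∀ {r s f} → r ≡₇ s → Avoid r f → Avoid s f
  Avoid-mod r≡s = Supp-weaken (λ i i≢r i≡s → i≢r (≡₇-trans i≡s (≡₇-sym r≡s)))

  Avoid-* : ∀ {d r g f} → Homog d g → Avoid r f → Avoid (d ℕ.+ r) (g * f)
  Avoid-* {d} {r} hg af = ⊛-Supp hg af (λ i j p ¬r eq → ¬r (≡₇-cancelˡ-+ p eq))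

  Avoid-Q : ∀ {r g f} → Avoid r f → Homog 0 g → Avoid r (f * g)
  Avoid-Q {g = g} {f} af hg = Supp-≈ (*-comm g f) (Avoid-* hg af)

  Homog⇒Avoid : ∀ {r f} → ¬ (r ≡₇ 0) → Homog 0 f → Avoid r f
  Homog⇒Avoid r≢0 = Supp-weaken (λ i i≡0 i≡r → r≢0 (≡₇-trans (≡₇-sym i≡r) i≡0))

  0-Supp : ∀ {P f} → f ≈ 0# → Supp N₀ P f
  0-Supp f≈0 = supp (λ i i<N → inj₂ (Agree.coeff f≈0 i (ℕ.<-≤-trans i<N N₀≤M)))

  Supp-Σ : ∀ {P} {g : ℕ → Series} n → (∀ k → Supp N₀ P (g k)) → Supp N₀ P (Σ g n)
  Supp-Σ zero    hg = 0-Supp refl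
  Supp-Σ (suc n) hg = ⊕-Supp (hg 0) (Supp-Σ n (hg ∘ suc))

  7≈0 : 7 ×′ 1# ≈ 0#
  7≈0 = agree (λ { zero _ → mod₇ ≡.refl ; (suc n) _ → ≡₇-refl })

  -- f ^ 7 is a series in q^7; this holds for all f, but closure under the operations is enough.
  Frob : Series → Set
  Frob f = Homog 0 (f ^ 7)

  Frob-+ : ∀ {f g} → Frob f → Frob g → Frob (f + g)
  Frob-+ {f} {g} hf hg = Supp-≈ (sym (freshman's-dream 7≈0 f g)) (⊕-Supp hf hg)

  Frob-* : ∀ {f g} → Frob f → Frob g → Frob (f * g)
  Frob-* {f} {g} hf hg = Supp-≈ (sym (^-distrib-* f g 7)) (Homog-* hf hg)

  Homog⇒Frob : ∀ {d f} → Homog d f → Frob f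
  Homog⇒Frob {d} hf = Homog-mod (≡₇-drop 0 d (ℕ.*-comm 7 d)) (Homog-^ 7 hf)

  Frob-1 : Frob 1#
  Frob-1 = Homog⇒Frob {0} (𝟙-Supp ≡₇-refl)

  Frob-Σ : ∀ {g} n → (∀ k → Frob (g k)) → Frob (Σ g n)
  Frob-Σ zero    hg = Homog⇒Frob {0} (0-Supp refl)
  Frob-Σ (suc n) hg = Frob-+ (hg 0) (Frob-Σ n (hg ∘ suc))

  open Gauss using (P; p)

  Frob-P : ∀ {d e Q u} n → Homog d Q → Homog e u → Frob (P Q u n)
  Frob-P zero    hQ hu = Frob-1
  Frob-P (suc n) hQ hu = Frob-* (Frob-P n hQ hu) (Frob-+ Frob-1 (Homog⇒Frob (Homog-* hu (Homog-^ n hQ))))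

  Frob-F : ∀ {d y} → Homog d y → Frob (F y)
  Frob-F hy = Frob-P M hy (⊝-Supp hy)

  Frob-F⁻¹ : ∀ {d y} → Homog d y → Frob (F⁻¹ y)
  Frob-F⁻¹ {d} {y} hy = go M
    where
    go : ∀ n → Frob (F⁻¹-upTo y n)
    go zero    = Frob-1
    go (suc n) = Frob-* (go n) (Frob-Σ M (λ k → Homog⇒Frob (Homog-^ k (Homog-* hy (Homog-^ n hy)))))

  X : ℕ → Series
  X zero    = q
  X (suc k) = X k * X k

  X-homog : ∀ k → Homog (degree k) (X k)
  X-homog zero    = q-Supp ≡₇-refl
  X-homog (suc k) = Homog-mod (≡⇒≡₇ (≡.cong (degree k ℕ.+_) (≡.sym (ℕ.+-identityʳ (degree k))))) (Homog-* (X-homog k) (X-homog k))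

  X-order : ∀ k → Supp M (degree k ≤_) (X k)
  X-order zero    = q-Supp ℕ.≤-refl
  X-order (suc k) = ⊛-Supp (X-order k) (X-order k)
    (λ i j d≤i d≤j → ℕ.+-mono-≤ d≤i (ℕ.≤-trans (ℕ.≤-reflexive (ℕ.+-identityʳ _)) d≤j))

  order⇒0 : ∀ {n f} → M ≤ n → Supp M (n ≤_) f → f ≈ 0#
  order⇒0 M≤n hf = agree (λ i i<M → [ (λ n≤i → ⊥-elim (ℕ.<⇒≱ i<M (ℕ.≤-trans M≤n n≤i))) , (λ e → e) ]′ (Supp.at hf i i<M))

  X^-order : ∀ k n → Supp M (n ≤_) (X k ^ n)
  X^-order k zero    = 𝟙-Supp z≤n
  X^-order k (suc n) = ⊛-Supp (X-order k) (X^-order k n) (λ i j d≤i n≤j → ℕ.+-mono-≤ (ℕ.≤-trans (degree-positive k) d≤i) n≤j)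

  X-nilpotent : ∀ k → X k ^ M ≈ 0#
  X-nilpotent k = order⇒0 ℕ.≤-refl (X^-order k M)

  X-vanish : ∀ k → M ≤ k → X k ≈ 0#
  X-vanish k M≤k = order⇒0 (ℕ.≤-trans M≤k (ℕ.<⇒≤ (degree-unbounded k))) (X-order k)

  open Chain M X (λ k → ≡.refl) X-nilpotent

  u-homog : ∀ k → Homog 0 (u k)
  u-homog k = Frob-F (X-homog k)

  -- The inverse of f_i^7 is again a seventh power of a series covered by `Frob`, so dividing by it
  -- moves no exponent to another class.
  u-cancel : ∀ {r} k {g} → Avoid r (g * u k) → Avoid r g
  u-cancel k {g} ag = Supp-≈ cancel (Avoid-Q ag (Frob-F⁻¹ (X-homog k)))
    where
    v = F⁻¹ (X k)
    cancel : (g * u k) * v ^ 7 ≈ g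
    cancel = begin
      (g * f k ^ 7) * v ^ 7   ≈⟨ *-assoc g (f k ^ 7) (v ^ 7) ⟩
      g * (f k ^ 7 * v ^ 7)   ≈⟨ *-congˡ {g} (^-distrib-* (f k) v 7) ⟨
      g * (f k * v) ^ 7       ≈⟨ *-congˡ {g} (^-congˡ 7 (trans (*-comm (f k) v) (F⁻¹-inverse (X-nilpotent k)))) ⟩
      g * 1# ^ 7              ≈⟨ *-congˡ {g} 1^7 ⟩
      g * 1#                  ≈⟨ *-identityʳ g ⟩
      g                       ∎
      where
      1^7 : 1# ^ 7 ≈ 1#
      1^7 = solve 0 (con 1 :^ 7 := con 1) refl
        where open import Algebra.Solver.Ring.NaturalCoefficients.Default commutativeSemiring

  u-cancel₂ : ∀ {r} j k {g} → Avoid r (g * (u j * u k)) → Avoid r g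
  u-cancel₂ j k {g} ag = u-cancel j (u-cancel k (Supp-≈ (sym (*-assoc g (u j) (u k))) ag))

  q^-shift : ∀ n g i → (q ^ n * g) (n ℕ.+ i) ≡ g i
  q^-shift zero    g i = ⊛-identityˡ g i
  q^-shift (suc n) g i = ≡.trans (⊛-assoc q (q ^ n) g (suc (n ℕ.+ i)))
    (≡.trans (⊛-identityˡ (q ^ n * g) (n ℕ.+ i)) (q^-shift n g i))

  -- With ε = q^N₀ we have ε² ≈ 0, and multiplication by ε is injective on series modulo q^N₀.
  cube≈jacobi : ∀ k i → i < N₀ → (f k ^ 3) i ≡₇ Σ (jacobiTerm (X k)) (suc (suc (M ℕ.+ M))) i
  cube≈jacobi k i i<N₀ = ≡₇-trans (≡⇒≡₇ (≡.sym (q^-shift N₀ (f k ^ 3) i)))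
    (≡₇-trans (Agree.coeff identity (N₀ ℕ.+ i) (ℕ.+-monoʳ-< N₀ i<N₀)) (≡⇒≡₇ (q^-shift N₀ series i)))
    where
    ε = q ^ N₀
    series = Σ (jacobiTerm (X k)) (suc (suc (M ℕ.+ M)))
    ε²≈0 : ε * ε ≈ 0#
    ε²≈0 = order⇒0 ℕ.≤-refl (⊛-Supp (X^-order 0 N₀) (X^-order 0 N₀) (λ i j → ℕ.+-mono-≤))
    identity : ε * f k ^ 3 ≈ ε * series
    identity = trans (*-congˡ {ε} (*-congˡ {f k} (*-congˡ {f k} (*-identityʳ (f k))))) (jacobi (X-nilpotent k) ε²≈0)

  -- Modulo 7 both 2n + 1 and n(n+1)/2 have period 7 in n. Among n = 0, ..., 6 the coefficient
  -- vanishes only for n = 3, whose triangular number 6 is the residue that disappears.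
  odd-coefficient : ∀ n → 1# + 2# * (n ×′ 1#) ≈ 0# ⊎ (∃[ s ] Tri s × triangular n ≡₇ s)
  odd-coefficient 0 = inj₂ (0 , tri₀ , ≡₇-refl)
  odd-coefficient 1 = inj₂ (1 , tri₁ , ≡₇-refl)
  odd-coefficient 2 = inj₂ (3 , tri₃ , ≡₇-refl)
  odd-coefficient 3 = inj₁ (trans (solve 0 (con 1 :+ (con 1 :+ con 1) :* (con 1 :+ (con 1 :+ (con 1 :+ con 0)))
    := con 1 :+ (con 1 :+ (con 1 :+ (con 1 :+ (con 1 :+ (con 1 :+ (con 1 :+ con 0))))))) refl) 7≈0)
    where open import Algebra.Solver.Ring.NaturalCoefficients.Default commutativeSemiring
  odd-coefficient 4 = inj₂ (3 , tri₃ , mod₇ ≡.refl)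
  odd-coefficient 5 = inj₂ (1 , tri₁ , mod₇ ≡.refl)
  odd-coefficient 6 = inj₂ (0 , tri₀ , mod₇ ≡.refl)
  odd-coefficient (suc (suc (suc (suc (suc (suc (suc n))))))) with odd-coefficient n
  ... | inj₁ c≈0 = inj₁ (trans (+-congˡ {1#} (*-congˡ {2#} period)) c≈0)
    where
    open import Algebra.Solver.Ring.NaturalCoefficients.Default commutativeSemiring
    period : (7 ℕ.+ n) ×′ 1# ≈ n ×′ 1#
    period = trans
      (solve 1 (λ m → con 1 :+ (con 1 :+ (con 1 :+ (con 1 :+ (con 1 :+ (con 1 :+ (con 1 :+ m))))))
        := (con 1 :+ (con 1 :+ (con 1 :+ (con 1 :+ (con 1 :+ (con 1 :+ (con 1 :+ con 0))))))) :+ m) refl (n ×′ 1#))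
      (trans (+-congʳ {n ×′ 1#} 7≈0) (+-identityˡ (n ×′ 1#)))
  -- Seven further summands n + 1, ..., n + 7 add 7n + 28 = 7 (n + 4).
  ... | inj₂ (s , s∈Tri , tri≡s) = inj₂ (s , s∈Tri , ≡₇-trans (≡₇-drop (triangular n) (n ℕ.+ 4) period) tri≡s)
    where
    open +-*-Solver
    period : triangular (7 ℕ.+ n) ≡ triangular n ℕ.+ (n ℕ.+ 4) ℕ.* 7
    period = solve 2 (λ t n → ((((((t :+ (con 1 :+ n)) :+ (con 2 :+ n)) :+ (con 3 :+ n)) :+ (con 4 :+ n)) :+ (con 5 :+ n)) :+ (con 6 :+ n)) :+ (con 7 :+ n)
      := t :+ (n :+ con 4) :* con 7) ≡.refl (triangular n) n

  p-homog : ∀ {d x} n → Homog d x → Homog (d ℕ.* triangular n) (p x x n)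
  p-homog {d} zero    hx = Homog-mod (≡⇒≡₇ (≡.sym (ℕ.*-zeroʳ d))) (𝟙-Supp ≡₇-refl)
  p-homog {d} (suc n) hx = Homog-mod (≡⇒≡₇ (solve 3 (λ d t n → d :* t :+ (d :+ n :* d) := d :* (t :+ (con 1 :+ n))) ≡.refl d (triangular n) n))
    (Homog-* (p-homog n hx) (Homog-* hx (Homog-^ n hx)))
    where open +-*-Solver

  Homog₀-* : ∀ {f g} → Homog 0 f → Homog 0 g → Homog 0 (f * g)
  Homog₀-* = Homog-*

  Homog₀-^ : ∀ {f} n → Homog 0 f → Homog 0 (f ^ n)
  Homog₀-^ zero    hf = 𝟙-Supp ≡₇-refl
  Homog₀-^ (suc n) hf = Homog₀-* hf (Homog₀-^ n hf)

  1-homog : Homog 0 1#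
  1-homog = 𝟙-Supp ≡₇-refl

  2-homog : Homog 0 2#
  2-homog = ⊕-Supp 1-homog 1-homog

  ×-homog : ∀ n → Homog 0 (n ×′ 1#)
  ×-homog zero    = 0-Supp refl
  ×-homog (suc n) = ⊕-Supp 1-homog (×-homog n)

  TriDegree : ℕ → ℕ → Set
  TriDegree d i = ∃[ s ] Tri s × i ≡₇ d ℕ.* s

  jacobiTerm-Supp : ∀ {d x} → Homog d x → ∀ n → Supp N₀ (TriDegree d) (jacobiTerm x n)
  jacobiTerm-Supp {d} {x} hx n with odd-coefficient n
  ... | inj₁ c≈0 = 0-Supp (trans (*-congʳ {p x x n} (trans (*-congˡ {(- 1#) ^ n} c≈0) (zeroʳ ((- 1#) ^ n)))) (zeroˡ (p x x n)))
  ... | inj₂ (s , s∈Tri , tri≡s) = Supp-weaken (λ i i≡ → s , s∈Tri , ≡₇-trans i≡ (*-cong₇ (≡₇-refl {d}) tri≡s))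
    (Homog-* (Homog₀-* (Homog₀-^ n (⊝-Supp 1-homog)) (⊕-Supp 1-homog (Homog₀-* 2-homog (×-homog n)))) (p-homog n hx))

  cube-Supp : ∀ k → Supp N₀ (TriDegree (degree k)) (f k ^ 3)
  cube-Supp k = Supp-map (λ _ x → x) (λ i i<N₀ e → ≡₇-trans (cube≈jacobi k i i<N₀) e)
    (Supp-Σ (suc (suc (M ℕ.+ M))) (jacobiTerm-Supp (X-homog k)))

  -- Every exponent that may occur is `degree k` times some s + c t modulo 7, and `degree k`, a
  -- power of 2, can be cancelled.
  cubes-avoid : ∀ k l {c r} → degree l ≡ c ℕ.* degree k → (∀ {s t} → Tri s → Tri t → ¬ (s ℕ.+ c ℕ.* t ≡₇ r)) →
    Avoid (degree k ℕ.* r) (f k ^ 3 * f l ^ 3)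
  cubes-avoid k l {c} {r} l≡ck avoid = ⊛-Supp (cube-Supp k) (cube-Supp l)
    (λ { i j (s , s∈ , i≡) (t , t∈ , j≡) i+j≡ → avoid s∈ t∈ (degree-cancel k
      (≡₇-trans (≡⇒≡₇ (eq s t)) (≡₇-trans (≡₇-sym (+-cong₇ i≡ j≡)) i+j≡))) })
    where
    eq : ∀ s t → degree k ℕ.* (s ℕ.+ c ℕ.* t) ≡ degree k ℕ.* s ℕ.+ degree l ℕ.* t
    eq s t = ≡.trans (solve 4 (λ d s c t → d :* (s :+ c :* t) := d :* s :+ (c :* d) :* t) ≡.refl (degree k) s c t)
      (≡.cong (λ e → degree k ℕ.* s ℕ.+ e ℕ.* t) (≡.sym l≡ck))
      where open +-*-Solver

  cubes-avoid-1-1 : ∀ k → Avoid (degree k ℕ.* 5) (f k ^ 3 * f k ^ 3)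
  cubes-avoid-1-1 k = cubes-avoid k k {1} (≡.sym (ℕ.*-identityˡ _)) tri-1-1

  cubes-avoid-1-2 : ∀ k → Avoid (degree k ℕ.* 4) (f k ^ 3 * f (1 ℕ.+ k) ^ 3)
  cubes-avoid-1-2 k = cubes-avoid k (1 ℕ.+ k) {2} ≡.refl tri-1-2

  cubes-avoid-1-4 : ∀ k → Avoid (degree k ℕ.* 2) (f k ^ 3 * f (2 ℕ.+ k) ^ 3)
  cubes-avoid-1-4 k = cubes-avoid k (2 ℕ.+ k) {4} (≡.sym (ℕ.*-assoc 2 2 (degree k))) tri-1-4

  -- The descent

  -- The classes are multiplied by `degree k` since the functions are taken at q^(2^k). Both signs
  -- are carried along because they mix: V of either sign leads to Z and V with sign minus, and Z to
  -- G with sign plus.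
  record Claims (k : ℕ) : Set where
    field
      G-avoid : ∀ s → Avoid (degree k ℕ.* 6) (G s k)
      Z-avoid : ∀ s → Avoid (degree k ℕ.* 3) (Z s k)
      V-avoid : ∀ s → Avoid (degree k ℕ.* 6) (V s k)
      E-avoid : Avoid (degree k ℕ.* 2) (E k)

  open Claims

  signed-Supp : ∀ {P} s {y} → Supp N₀ P y → Supp N₀ P (signed s y)
  signed-Supp pos hy = hy
  signed-Supp neg hy = ⊝-Supp hy

  -- At these levels q^(2^k) is zero in the ring, so all functions are constants; 6, 3, 6 and 2
  -- remain nonzero modulo 7 after multiplication by the invertible `degree k`.
  claims-zero : ∀ k → M ≤ k → Claims k
  claims-zero k M≤k = record
    { G-avoid = λ s → avoid (λ { (mod₇ ()) }) (Homog₀-* (hφ s) (Homog₀-^ 5 (hf 1)))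
    ; Z-avoid = λ s → avoid (λ { (mod₇ ()) }) (Homog₀-* (hφ s) (Homog₀-^ 5 (hf 3)))
    ; V-avoid = λ s → avoid (λ { (mod₇ ()) }) (Homog₀-* (hφ s) (Homog₀-* (Homog₀-* (Homog₀-^ 2 (hf 1)) (hf 2)) (Homog₀-^ 2 (hf 3))))
    ; E-avoid = avoid (λ { (mod₇ ()) }) (Homog₀-* (Homog₀-^ 4 (hf 0)) (Homog₀-^ 2 (hf 1)))
    }
    where
    avoid : ∀ {r g} → ¬ (r ≡₇ 0) → Homog 0 g → Avoid (degree k ℕ.* r) g
    avoid r≢0 = Homog⇒Avoid (λ dr≡0 → r≢0 (degree-cancel k (≡₇-trans dr≡0 (≡⇒≡₇ (≡.sym (ℕ.*-zeroʳ (degree k)))))))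
    hX : ∀ j → Homog 0 (X (j ℕ.+ k))
    hX j = 0-Supp (X-vanish (j ℕ.+ k) (ℕ.≤-trans M≤k (ℕ.m≤n+m k j)))
    hP : ∀ {Q y} n → Homog 0 Q → Homog 0 y → Homog 0 (P Q y n)
    hP zero    hQ hy = 1-homog
    hP (suc n) hQ hy = Homog₀-* (hP n hQ hy) (⊕-Supp 1-homog (Homog₀-* hy (Homog₀-^ n hQ)))
    hF : ∀ {y} → Homog 0 y → Homog 0 (F y)
    hF hy = hP M hy (⊝-Supp hy)
    hf : ∀ j → Homog 0 (f (j ℕ.+ k))
    hf j = hF (hX j)
    hφ : ∀ s → Homog 0 (φ s k)
    hφ s = Homog₀-* (hF hw²) (Homog₀-* hp hp)
      where
      hw = signed-Supp s (hX 0)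
      hw² = Homog₀-* hw hw
      hp = hP M hw² hw

  -- The odd part carries the factor ± 2 X k, which moves the class t to `degree k` + t.
  dissection-avoid : ∀ s k g {r t} → degree k ℕ.+ t ≡₇ r →
    Avoid r (φ pos (2 ℕ.+ k) * g) → Avoid t (ψ (3 ℕ.+ k) * g) → Avoid r (φ s k * g)
  dissection-avoid s k g k+t≡r a₀ a₁ = Supp-≈ (sym (dissect-product s k g))
    (⊕-Supp a₀ (Avoid-mod (≡₇-trans (+-cong₇ (≡⇒≡₇ (ℕ.+-identityʳ (degree k))) ≡₇-refl) k+t≡r)
      (Avoid-* (Homog-* (signed-Supp s (X-homog k)) 2-homog) a₁)))

  coefficient-homog : ∀ k → Homog (degree k) (- X k * 2# ^ 2)
  coefficient-homog k = Homog-mod (≡⇒≡₇ (ℕ.+-identityʳ (degree k))) (Homog-* (⊝-Supp (X-homog k)) (Homog₀-^ 2 2-homog))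

  module _ (k : ℕ) where
    private
      open +-*-Solver
      d = degree k

    G-step : Claims (1 ℕ.+ k) → ∀ s → Avoid (degree k ℕ.* 6) (G s k)
    G-step c s = dissection-avoid s k (f (1 ℕ.+ k) ^ 5)
      (≡₇-drop (d ℕ.* 6) d (solve 1 (λ d → d :+ (con 2 :* d) :* con 6 := d :* con 6 :+ d :* con 7) ≡.refl d))
      (Avoid-mod (≡⇒≡₇ (solve 1 (λ d → (con 2 :* d) :* con 3 := d :* con 6) ≡.refl d))
        (u-cancel₂ (2 ℕ.+ k) (4 ℕ.+ k) (Supp-≈ (sym (G-even k))
          (Avoid-Q (Z-avoid c pos) (Homog₀-* (u-homog (1 ℕ.+ k)) (u-homog (3 ℕ.+ k)))))))
      (u-cancel (2 ℕ.+ k) (Supp-≈ (sym (G-odd k)) (Avoid-Q (V-avoid c pos) (u-homog (1 ℕ.+ k)))))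

    Z-step : Claims (2 ℕ.+ k) → Claims (3 ℕ.+ k) → ∀ s → Avoid (degree k ℕ.* 3) (Z s k)
    Z-step c₂ c₃ s = dissection-avoid s k (f (3 ℕ.+ k) ^ 5)
      (≡₇-drop (d ℕ.* 3) (d ℕ.* 2) (solve 1 (λ d → d :+ (con 2 :* (con 2 :* (con 2 :* d))) :* con 2 := d :* con 3 :+ (d :* con 2) :* con 7) ≡.refl d))
      (Avoid-mod (≡₇-drop (d ℕ.* 3) (d ℕ.* 3) (solve 1 (λ d → (con 2 :* (con 2 :* d)) :* con 6 := d :* con 3 :+ (d :* con 3) :* con 7) ≡.refl d))
        (G-avoid c₂ pos))
      (Supp-≈ (sym (Z-odd (3 ℕ.+ k))) (E-avoid c₃))

    V-step : Claims (1 ℕ.+ k) → ∀ s → Avoid (degree k ℕ.* 6) (V s k)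
    V-step c s = dissection-avoid s k ((f (1 ℕ.+ k) ^ 2 * f (2 ℕ.+ k)) * f (3 ℕ.+ k) ^ 2)
      (≡₇-drop (d ℕ.* 6) d (solve 1 (λ d → d :+ (con 2 :* d) :* con 6 := d :* con 6 :+ d :* con 7) ≡.refl d))
      (Avoid-mod (≡⇒≡₇ (solve 1 (λ d → (con 2 :* d) :* con 3 := d :* con 6) ≡.refl d))
        (u-cancel (4 ℕ.+ k) (Supp-≈ (sym (V-even k)) (Avoid-Q (Z-avoid c neg) (u-homog (3 ℕ.+ k))))))
      (Supp-≈ (sym (V-odd k)) (V-avoid c neg))

  -- With d the degree of X j, the three parts have to avoid 2d, d and d, the last two behind a
  -- factor -4 X j. The classes supplied are 4 · 4 d = 16 d ≡ 2d for the first, 4 · 2 d = 8d ≡ d for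
  -- the second, and 2d + 8 · 6 d = 50 d ≡ d for the third.
  E-step : ∀ k → let j = 1 ℕ.+ k in Claims (3 ℕ.+ j) → Avoid (degree j ℕ.* 2) (E j)
  E-step k c = Supp-≈ (sym (E-expansion k)) (⊕-Supp first
    (Avoid-mod (≡⇒≡₇ (solve 1 (λ d → d :+ d := d :* con 2) ≡.refl d))
      (Avoid-* (coefficient-homog j) (⊕-Supp second third))))
    where
    open +-*-Solver
    j = 1 ℕ.+ k
    d = degree j
    first : Avoid (d ℕ.* 2) (φ pos (1 ℕ.+ j) ^ 2 * f (1 ℕ.+ j) ^ 4)
    first = Avoid-mod (≡₇-drop (d ℕ.* 2) (d ℕ.* 2) (solve 1 (λ d → (con 2 :* (con 2 :* d)) :* con 4 := d :* con 2 :+ (d :* con 2) :* con 7) ≡.refl d))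
      (u-cancel (3 ℕ.+ j) (Supp-≈ (sym (E-even (1 ℕ.+ j))) (Avoid-Q (cubes-avoid-1-2 (2 ℕ.+ j)) (u-homog (2 ℕ.+ j)))))
    second : Avoid d (φ pos (2 ℕ.+ j) ^ 2 * f (3 ℕ.+ j) ^ 4)
    second = Avoid-mod (≡₇-drop d d (solve 1 (λ d → (con 2 :* (con 2 :* d)) :* con 2 := d :+ d :* con 7) ≡.refl d))
      (u-cancel₂ (2 ℕ.+ j) (4 ℕ.+ j) (Supp-≈ (sym (E-odd (2 ℕ.+ j)))
        (Avoid-Q (cubes-avoid-1-4 (2 ℕ.+ j)) (Homog₀-* (u-homog (3 ℕ.+ j)) (u-homog (3 ℕ.+ j))))))
    third : Avoid d ((- X (1 ℕ.+ j) * 2# ^ 2) * G neg (3 ℕ.+ j))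
    third = Avoid-mod (≡₇-drop d (d ℕ.* 7) (solve 1 (λ d → con 2 :* d :+ (con 2 :* (con 2 :* (con 2 :* d))) :* con 6 := d :+ (d :* con 7) :* con 7) ≡.refl d))
      (Avoid-* (coefficient-homog (1 ℕ.+ j)) (G-avoid c neg))

  -- The descent raises the level, so `fuel` counts down the distance to M. Level 0 is left out
  -- because the expansion of E needs a square root of X.
  claims : ∀ fuel k → M ≤ fuel ℕ.+ suc k → Claims (suc k)
  claims zero       k M≤ = claims-zero (suc k) M≤
  claims (suc fuel) k M≤ = record
    { G-avoid = G-step (1 ℕ.+ k) c₁
    ; Z-avoid = Z-step (1 ℕ.+ k) c₂ c₃
    ; V-avoid = V-step (1 ℕ.+ k) c₁
    ; E-avoid = E-step k c₃
    }
    where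
    M≤₁ : M ≤ fuel ℕ.+ (2 ℕ.+ k)
    M≤₁ = ℕ.≤-trans M≤ (ℕ.≤-reflexive (≡.sym (ℕ.+-suc fuel (suc k))))
    c₁ = claims fuel (1 ℕ.+ k) M≤₁
    c₂ = claims fuel (2 ℕ.+ k) (ℕ.≤-trans M≤₁ (ℕ.+-monoʳ-≤ fuel (ℕ.n≤1+n _)))
    c₃ = claims fuel (3 ℕ.+ k) (ℕ.≤-trans M≤₁ (ℕ.+-monoʳ-≤ fuel (ℕ.m≤n+m _ 2)))

-- Counting partitions

open import Defs

sumTo : (ℕ → ℕ) → ℕ → ℕ
sumTo g zero    = 0
sumTo g (suc n) = g 0 ℕ.+ sumTo (g ∘ suc) n

sumTo-cong : ∀ {g h} n → (∀ m → g m ≡ h m) → sumTo g n ≡ sumTo h n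
sumTo-cong zero    e = ≡.refl
sumTo-cong (suc n) e = ≡.cong₂ ℕ._+_ (e 0) (sumTo-cong n (e ∘ suc))

sumTo-zero : ∀ {g} n → (∀ m → g m ≡ 0) → sumTo g n ≡ 0
sumTo-zero zero    e = ≡.refl
sumTo-zero (suc n) e = ≡.cong₂ ℕ._+_ (e 0) (sumTo-zero n (e ∘ suc))

sumTo-extend : ∀ {g} n k → (∀ m → n ≤ m → g m ≡ 0) → sumTo g (n ℕ.+ k) ≡ sumTo g n
sumTo-extend zero    k e = sumTo-zero k (λ m → e m z≤n)
sumTo-extend {g} (suc n) k e = ≡.cong (g 0 ℕ.+_) (sumTo-extend n k (λ m n≤m → e (suc m) (s≤s n≤m)))

-- Multiplicities that do not fit contribute 0 instead of being filtered out, so that sums over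
-- ranges of different length can be compared.
copies : (ℕ → ℕ) → ℕ → ℕ → ℕ → ℕ
copies h t n m = if m ℕ.* t ≤ᵇ n then h (n ℕ.∸ m ℕ.* t) else 0

copies-≤ : ∀ {h t n m} → m ℕ.* t ≤ n → copies h t n m ≡ h (n ℕ.∸ m ℕ.* t)
copies-≤ {h} {t} {n} {m} mt≤n with m ℕ.* t ≤ᵇ n | ℕ.≤⇒≤ᵇ mt≤n
... | true | _ = ≡.refl

copies-> : ∀ {h t n m} → n < m ℕ.* t → copies h t n m ≡ 0
copies-> {h} {t} {n} {m} n<mt with m ℕ.* t ≤ᵇ n | ℕ.≤ᵇ⇒≤ (m ℕ.* t) n
... | true  | mt≤n = ⊥-elim (ℕ.<⇒≱ n<mt (mt≤n _))
... | false | _    = ≡.refl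

copies-map : ∀ {h h' t t' n n' m m'} → (m ℕ.* t ≤ n → m' ℕ.* t' ≤ n') → (m' ℕ.* t' ≤ n' → m ℕ.* t ≤ n) →
  (m ℕ.* t ≤ n → h (n ℕ.∸ m ℕ.* t) ≡ h' (n' ℕ.∸ m' ℕ.* t')) → copies h t n m ≡ copies h' t' n' m'
copies-map {h} {h'} {t} {t'} {n} {n'} {m} {m'} to from e with m ℕ.* t ≤? n
... | yes mt≤n = ≡.trans (copies-≤ {h} {t} {n} {m} mt≤n) (≡.trans (e mt≤n) (≡.sym (copies-≤ {h'} {t'} {n'} {m'} (to mt≤n))))
... | no  mt≰n = ≡.trans (copies-> {h} {t} {n} {m} (ℕ.≰⇒> mt≰n)) (≡.sym (copies-> {h'} {t'} {n'} {m'} (ℕ.≰⇒> (mt≰n ∘ from))))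

filter-sum : ∀ h t n (f : ℕ → ℕ) L →
  sum (map (λ m → h (n ℕ.∸ m ℕ.* t)) (filter (λ m → m ℕ.* t ≤? n) (applyUpTo f L))) ≡ sumTo (copies h t n ∘ f) L
filter-sum h t n f zero    = ≡.refl
filter-sum h t n f (suc L) with f 0 ℕ.* t ≤ᵇ n
... | true  = ≡.cong (h (n ℕ.∸ f 0 ℕ.* t) ℕ.+_) (filter-sum h t n (f ∘ suc) L)
... | false = filter-sum h t n (f ∘ suc) L

count-∷ : ∀ t ts n → countMultisets (t ∷ ts) n ≡ sumTo (copies (countMultisets ts) t n) (suc n)
count-∷ t ts n = filter-sum (countMultisets ts) t n id (suc n)

copies-tail : ∀ h {t} → 1 ≤ t → ∀ n m → n < m → copies h t n m ≡ 0
copies-tail h {t} 1≤t n m n<m = copies-> {h} {t} {n} {m} (ℕ.≤-trans n<m (ℕ.m≤m*n m t {{ℕ.>-nonZero 1≤t}}))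

count-∷-< : ∀ t ts i → i < t → countMultisets (t ∷ ts) i ≡ countMultisets ts i
count-∷-< t ts i i<t = begin
  countMultisets (t ∷ ts) i                                          ≡⟨ count-∷ t ts i ⟩
  countMultisets ts i ℕ.+ sumTo (copies (countMultisets ts) t i ∘ suc) i
    ≡⟨ ≡.cong (countMultisets ts i ℕ.+_) (sumTo-zero i (λ m → copies-> {countMultisets ts} {t} {i} {suc m} (ℕ.≤-trans i<t (ℕ.m≤m+n t _)))) ⟩
  countMultisets ts i ℕ.+ 0                                          ≡⟨ ℕ.+-identityʳ _ ⟩
  countMultisets ts i                                                ∎
  where open ≡.≡-Reasoning

-- A multiset either does not use the first type or contains a copy of it that can be removed.
count-∷-+ : ∀ t ts i → countMultisets (suc t ∷ ts) (suc t ℕ.+ i) ≡ countMultisets ts (suc t ℕ.+ i) ℕ.+ countMultisets (suc t ∷ ts) i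
count-∷-+ t' ts i = begin
  countMultisets (t ∷ ts) (t ℕ.+ i)
    ≡⟨ count-∷ t ts (t ℕ.+ i) ⟩
  h (t ℕ.+ i) ℕ.+ sumTo (copies h t (t ℕ.+ i) ∘ suc) (t ℕ.+ i)
    ≡⟨ ≡.cong (h (t ℕ.+ i) ℕ.+_) (sumTo-cong (t ℕ.+ i) shift) ⟩
  h (t ℕ.+ i) ℕ.+ sumTo (copies h t i) (t ℕ.+ i)
    ≡⟨ ≡.cong (λ L → h (t ℕ.+ i) ℕ.+ sumTo (copies h t i) (suc L)) (ℕ.+-comm t' i) ⟩
  h (t ℕ.+ i) ℕ.+ sumTo (copies h t i) (suc i ℕ.+ t')
    ≡⟨ ≡.cong (h (t ℕ.+ i) ℕ.+_) (sumTo-extend (suc i) t' (copies-tail h {t} (s≤s z≤n) i)) ⟩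
  h (t ℕ.+ i) ℕ.+ sumTo (copies h t i) (suc i)
    ≡⟨ ≡.cong (h (t ℕ.+ i) ℕ.+_) (count-∷ t ts i) ⟨
  h (t ℕ.+ i) ℕ.+ countMultisets (t ∷ ts) i ∎
  where
  open ≡.≡-Reasoning
  t = suc t'
  h = countMultisets ts
  shift : ∀ m → copies h t (t ℕ.+ i) (suc m) ≡ copies h t i m
  shift m = copies-map {h} {h} {t} {t} {t ℕ.+ i} {i} {suc m} {m}
    (ℕ.+-cancelˡ-≤ t _ _) (ℕ.+-monoʳ-≤ t) (λ _ → ≡.cong h (ℕ.[m+n]∸[m+o]≡n∸o t i (m ℕ.* t)))

count-++-large : ∀ ts bs n → All (n <_) bs → countMultisets (ts ++ bs) n ≡ countMultisets ts n
count-++-large []       []       n []           = ≡.refl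
count-++-large []       (b ∷ bs) n (n<b ∷ n<bs) = ≡.trans (count-∷-< b bs n n<b) (count-++-large [] bs n n<bs)
count-++-large (t ∷ ts) bs       n n<bs         = ≡.trans (count-∷ t (ts ++ bs) n)
  (≡.trans (sumTo-cong {copies (countMultisets (ts ++ bs)) t n} {copies (countMultisets ts) t n} (suc n) (λ m → copies-map {countMultisets (ts ++ bs)} {countMultisets ts} {t} {t} {n} {n} {m} {m} id id
      (λ _ → count-++-large ts bs _ (All.map (ℕ.≤-<-trans (ℕ.m∸n≤m n (m ℕ.* t))) n<bs))))
    (≡.sym (count-∷ t ts n)))

double : ℕ → ℕ
double n = n ℕ.+ n

double-∸ : ∀ m n → double m ℕ.∸ double n ≡ double (m ℕ.∸ n)
double-∸ m       zero    = ≡.refl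
double-∸ zero    (suc n) = ≡.refl
double-∸ (suc m) (suc n) = ≡.trans (≡.cong₂ ℕ._∸_ (ℕ.+-suc m m) (ℕ.+-suc n n)) (double-∸ m n)

double-cancel-≤ : ∀ {m n} → double m ≤ double n → m ≤ n
double-cancel-≤ {m} {n} 2m≤2n with m ≤? n
... | yes m≤n = m≤n
... | no  m≰n = ⊥-elim (ℕ.<⇒≱ (ℕ.+-mono-< (ℕ.≰⇒> m≰n) (ℕ.≰⇒> m≰n)) 2m≤2n)

count-double : ∀ ts → All (1 ≤_) ts → ∀ n → countMultisets (map double ts) (double n) ≡ countMultisets ts n
count-double []       _            zero    = ≡.refl
count-double []       _            (suc n) = ≡.refl
count-double (t ∷ ts) (1≤t ∷ 1≤ts) n       = begin
  countMultisets (double t ∷ map double ts) (double n)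
    ≡⟨ count-∷ (double t) (map double ts) (double n) ⟩
  sumTo (copies (countMultisets (map double ts)) (double t) (double n)) (suc n ℕ.+ n)
    ≡⟨ sumTo-cong (suc n ℕ.+ n) term ⟩
  sumTo (copies (countMultisets ts) t n) (suc n ℕ.+ n)
    ≡⟨ sumTo-extend (suc n) n (copies-tail (countMultisets ts) 1≤t n) ⟩
  sumTo (copies (countMultisets ts) t n) (suc n)
    ≡⟨ count-∷ t ts n ⟨
  countMultisets (t ∷ ts) n ∎
  where
  open ≡.≡-Reasoning
  term : ∀ m → copies (countMultisets (map double ts)) (double t) (double n) m ≡ copies (countMultisets ts) t n m
  term m = copies-map {countMultisets (map double ts)} {countMultisets ts} {double t} {t} {double n} {n} {m} {m}
    (double-cancel-≤ ∘ ≡.subst (_≤ double n) m*2t)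
    (λ mt≤n → ≡.subst (_≤ double n) (≡.sym m*2t) (ℕ.+-mono-≤ mt≤n mt≤n))
    (λ _ → ≡.trans (≡.cong (countMultisets (map double ts)) (≡.trans (≡.cong (double n ℕ.∸_) m*2t) (double-∸ n (m ℕ.* t))))
                   (count-double ts 1≤ts (n ℕ.∸ m ℕ.* t)))
    where
    m*2t : m ℕ.* double t ≡ double (m ℕ.* t)
    m*2t = ℕ.*-distribˡ-+ m t t

partTypes-suc : ∀ k n → partTypes k (suc n) ≡ partTypes k n ++ replicate (colors k (suc n)) (suc n)
partTypes-suc k n = begin
  concatMap g (map suc (upTo (suc n)))                 ≡⟨ ≡.cong (concatMap g ∘ map suc) (List.upTo-∷ʳ n) ⟨
  concatMap g (map suc (upTo n ++ n ∷ []))             ≡⟨ ≡.cong (concatMap g) (List.map-++ suc (upTo n) (n ∷ [])) ⟩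
  concatMap g (map suc (upTo n) ++ suc n ∷ [])         ≡⟨ List.concatMap-++ g (map suc (upTo n)) (suc n ∷ []) ⟩
  partTypes k n ++ (g (suc n) ++ [])                   ≡⟨ ≡.cong (partTypes k n ++_) (List.++-identityʳ (g (suc n))) ⟩
  partTypes k n ++ g (suc n)                           ∎
  where
  open ≡.≡-Reasoning
  g = λ j → replicate (colors k j) j

partTypes-positive : ∀ k n → All (1 ≤_) (partTypes k n)
partTypes-positive k zero    = []
partTypes-positive k (suc n) = ≡.subst (All (1 ≤_)) (≡.sym (partTypes-suc k n))
  (All.++⁺ (partTypes-positive k n) (All.replicate⁺ (colors k (suc n)) (s≤s z≤n)))

-- The list of types in the definition of `a k n` grows with n. Types larger than n cannot be used,
-- so one long list serves as the source of a generating function.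
count-partTypes : ∀ k m n → countMultisets (partTypes k (m ℕ.+ n)) n ≡ a k n
count-partTypes k zero    n = ≡.refl
count-partTypes k (suc m) n = ≡.trans (≡.cong (λ ts → countMultisets ts n) (partTypes-suc k (m ℕ.+ n)))
  (≡.trans (count-++-large (partTypes k (m ℕ.+ n)) _ n (All.replicate⁺ (colors k (suc (m ℕ.+ n))) (s≤s (ℕ.m≤n+m n m))))
    (count-partTypes k m n))

double≡*2 : ∀ m → double m ≡ m ℕ.* 2
double≡*2 m = ≡.sym (≡.trans (ℕ.*-comm m 2) (≡.cong (m ℕ.+_) (ℕ.+-identityʳ m)))

colors-odd : ∀ k m → colors k (suc (double m)) ≡ k
colors-odd k m rewrite ≡.trans (≡.cong (λ j → suc j % 2) (double≡*2 m)) ([m+kn]%n≡m%n 1 m 2) = ≡.refl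

colors-even : ∀ k m → colors k (suc (suc (double m))) ≡ 1
colors-even k m rewrite ≡.trans (≡.cong (λ j → suc (suc j) % 2) (double≡*2 m)) ([m+kn]%n≡m%n 2 m 2) = ≡.refl

-- All part sizes are doubled: the dissection of φ(-x)² at x = q² is obtained from the square root q of x.
module GeneratingFunction (n : ℕ) where

  open Truncation (suc (double n))
  open CommutativeRing R hiding (zero)
  open import Algebra.Properties.Ring ring using (-‿distribˡ-*)
  open import Algebra.Properties.CommutativeSemiring.Exp commutativeSemiring
  open import Algebra.Solver.Ring.NaturalCoefficients.Default commutativeSemiring
    using (solve; _:=_; _:+_; _:*_; _:^_; con)
  open FormalTheta R
  open Truncated M
  open Gauss using (P)
  open Chain M X (λ k → ≡.refl) X-nilpotent
  open import Relation.Binary.Reasoning.Setoid setoid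

  factor : ℕ → Series
  factor t = 1# + - (q ^ t)

  factors : List ℕ → Series
  factors []       = 1#
  factors (t ∷ ts) = factor t * factors ts

  factors-++ : ∀ ts us → factors (ts ++ us) ≈ factors ts * factors us
  factors-++ []       us = sym (*-identityˡ (factors us))
  factors-++ (t ∷ ts) us = trans (*-congˡ {factor t} (factors-++ ts us)) (sym (*-assoc (factor t) (factors ts) (factors us)))

  factors-replicate : ∀ c t → factors (replicate c t) ≈ factor t ^ c
  factors-replicate zero    t = refl
  factors-replicate (suc c) t = *-congˡ {factor t} (factors-replicate c t)

  -- With g and h the two generating functions this is (1 - q^t) g = h, t being the size of the
  -- first type. Exponents below t see only h, the others are shifted by `count-∷-+`.
  count-recurrence : ∀ t ts → countMultisets (suc t ∷ ts) ≈ countMultisets ts + q ^ suc t * countMultisets (suc t ∷ ts)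
  count-recurrence t' ts = agree coeff
    where
    t = suc t'
    g = countMultisets (t ∷ ts)
    h = countMultisets ts
    order : Supp M (t ≤_) (q ^ t * g)
    order = ⊛-Supp {Q = λ _ → ⊤} (X^-order 0 t) (supp (λ i _ → inj₁ tt)) (λ i j t≤i _ → ℕ.≤-trans t≤i (ℕ.m≤m+n i j))
    coeff : ∀ i → i < M → g i ≡₇ h i ℕ.+ (q ^ t * g) i
    coeff i i<M with t ≤? i
    ... | no  t≰i = [ (λ t≤i → ⊥-elim (t≰i t≤i)) , (λ e → ≡₇-trans (≡⇒≡₇ (≡.trans (count-∷-< t ts i (ℕ.≰⇒> t≰i)) (≡.sym (ℕ.+-identityʳ _))))
                        (+-cong₇ (≡₇-refl {h i}) (≡₇-sym e))) ]′ (Supp.at order i i<M)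
    ... | yes t≤i = ≡.subst (λ i → g i ≡₇ h i ℕ.+ (q ^ t * g) i) (ℕ.m+[n∸m]≡n t≤i)
      (≡⇒≡₇ (≡.trans (count-∷-+ t' ts j) (≡.cong (h (t ℕ.+ j) ℕ.+_) (≡.sym (q^-shift t g j)))))
      where j = i ℕ.∸ t

  count-factors : ∀ ts → All (1 ≤_) ts → countMultisets ts * factors ts ≈ 1#
  count-factors []           _           = trans (*-identityʳ (countMultisets [])) (agree (λ { zero _ → ≡₇-refl ; (suc i) _ → ≡₇-refl }))
  count-factors (suc t ∷ ts) (_ ∷ 1≤ts) = begin
    g * ((1# + - y) * factors ts)          ≈⟨ solve 3 (λ g m w → g :* ((con 1 :+ m) :* w) := (g :+ m :* g) :* w) refl g (- y) (factors ts) ⟩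
    (g + - y * g) * factors ts             ≈⟨ *-congʳ {factors ts} (+-congʳ { - y * g} (count-recurrence t ts)) ⟩
    ((h + y * g) + - y * g) * factors ts   ≈⟨ *-congʳ {factors ts} (solve 4 (λ h y g m → (h :+ y :* g) :+ m :* g := h :+ (y :+ m) :* g) refl h y g (- y)) ⟩
    (h + (y + - y) * g) * factors ts       ≈⟨ *-congʳ {factors ts} (+-congˡ {h} (trans (*-congʳ {g} (-‿inverseʳ y)) (zeroˡ g))) ⟩
    (h + 0#) * factors ts                  ≈⟨ *-congʳ {factors ts} (+-identityʳ h) ⟩
    h * factors ts                         ≈⟨ count-factors ts 1≤ts ⟩
    1#                                     ∎
    where
    g = countMultisets (suc t ∷ ts)
    h = countMultisets ts
    y = q ^ suc t

  x : Series
  x = X 1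

  factors-partTypes-suc : ∀ k m → factors (map double (partTypes k (suc m)))
    ≈ factors (map double (partTypes k m)) * (1# + - (x ^ suc m)) ^ colors k (suc m)
  factors-partTypes-suc k m = begin
    factors (map double (partTypes k (suc m)))
      ≡⟨ ≡.cong (factors ∘ map double) (partTypes-suc k m) ⟩
    factors (map double (partTypes k m ++ replicate c (suc m)))
      ≡⟨ ≡.cong factors (≡.trans (List.map-++ double (partTypes k m) _) (≡.cong (map double (partTypes k m) ++_) (List.map-replicate double c (suc m)))) ⟩
    factors (map double (partTypes k m) ++ replicate c (double (suc m)))
      ≈⟨ factors-++ (map double (partTypes k m)) (replicate c (double (suc m))) ⟩
    w * factors (replicate c (double (suc m)))
      ≈⟨ *-congˡ {w} (trans (factors-replicate c (double (suc m))) (^-congˡ c (+-congˡ {1#} (-‿cong (^-double q (suc m)))))) ⟩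
    w * (1# + - (x ^ suc m)) ^ c ∎
    where
    c = colors k (suc m)
    w = factors (map double (partTypes k m))

  factors-partTypes : ∀ k m → factors (map double (partTypes k (double m))) ≈ P (x * x) (- x) m ^ k * P (x * x) (- (x * x)) m
  factors-partTypes k zero    = sym (trans (*-identityʳ (1# ^ k)) (1^ k))
    where
    1^ : ∀ k → 1# ^ k ≈ 1#
    1^ zero    = refl
    1^ (suc k) = trans (*-identityˡ (1# ^ k)) (1^ k)
  factors-partTypes k (suc m) = begin
    factors (map double (partTypes k (suc (m ℕ.+ suc m))))
      ≡⟨ ≡.cong (λ j → factors (map double (partTypes k (suc j)))) (ℕ.+-suc m m) ⟩
    factors (map double (partTypes k (suc (suc (double m)))))
      ≈⟨ trans (factors-partTypes-suc k (suc (double m))) (*-congʳ {y₂ ^ colors k (suc (suc (double m)))} (factors-partTypes-suc k (double m))) ⟩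
    (w * y₁ ^ colors k (suc (double m))) * y₂ ^ colors k (suc (suc (double m)))
      ≡⟨ ≡.cong₂ (λ c d → (w * y₁ ^ c) * y₂ ^ d) (colors-odd k m) (colors-even k m) ⟩
    (w * y₁ ^ k) * y₂ ^ 1
      ≈⟨ *-cong (*-cong (factors-partTypes k m) (^-congˡ k odd)) (trans (*-identityʳ y₂) even) ⟩
    ((o ^ k * e) * (1# + - x * r) ^ k) * (1# + - (x * x) * r)
      ≈⟨ solve 4 (λ a e b c → ((a :* e) :* b) :* c := (a :* b) :* (e :* c)) refl (o ^ k) e ((1# + - x * r) ^ k) (1# + - (x * x) * r) ⟩
    (o ^ k * (1# + - x * r) ^ k) * (e * (1# + - (x * x) * r))
      ≈⟨ *-congʳ {e * (1# + - (x * x) * r)} (^-distrib-* o (1# + - x * r) k) ⟨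
    P (x * x) (- x) (suc m) ^ k * P (x * x) (- (x * x)) (suc m) ∎
    where
    w = factors (map double (partTypes k (double m)))
    y₁ = 1# + - (x ^ suc (double m))
    y₂ = 1# + - (x ^ suc (suc (double m)))
    o = P (x * x) (- x) m
    e = P (x * x) (- (x * x)) m
    r = (x * x) ^ m
    odd : y₁ ≈ 1# + - x * r
    odd = +-congˡ {1#} (trans (-‿distribˡ-* x (x ^ double m)) (*-congˡ { - x} (^-double x m)))
    even : y₂ ≈ 1# + - (x * x) * r
    even = +-congˡ {1#} (trans (-‿cong (sym (*-assoc x x (x ^ double m)))) (trans (-‿distribˡ-* (x * x) (x ^ double m)) (*-congˡ { - (x * x)} (^-double x m))))

  -- The sizes up to 2M form M odd and M even ones, the number of factors in the truncated `F`, so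
  -- the products match without a further limit.
  gf : ℕ → Series
  gf k = countMultisets (map double (partTypes k (double M)))

  gf-coefficient : ∀ k → gf k (double n) ≡ a k n
  gf-coefficient k = ≡.trans (count-double (partTypes k (double M)) (partTypes-positive k (double M)) n)
    (≡.trans (≡.cong (λ m → countMultisets (partTypes k m) n) (≡.sym (ℕ.m∸n+n≡m n≤2M)))
      (count-partTypes k (double M ℕ.∸ n) n))
    where
    n≤2M : n ≤ double M
    n≤2M = ℕ.≤-trans (ℕ.≤-trans (ℕ.m≤n⇒m≤1+n (ℕ.m≤m+n n n)) N₀≤M) (ℕ.m≤m+n M M)

  -- The odd sizes give the product of f_1 / f_2 by `F-split`. Its power k + 1 times f_2 from the
  -- even sizes is f_1^(k+1) / f_2^k, all at x = q^2.
  gf-product : ∀ k → gf (suc k) * f 1 ^ suc k ≈ f 2 ^ k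
  gf-product k = begin
    g * f 1 ^ suc k                        ≈⟨ *-congˡ {g} (trans (^-congˡ (suc k) (F-split (X-nilpotent 1))) (^-distrib-* o (f 2) (suc k))) ⟩
    g * (o ^ suc k * (f 2 * f 2 ^ k))      ≈⟨ solve 4 (λ g a b c → g :* (a :* (b :* c)) := (g :* (a :* b)) :* c) refl g (o ^ suc k) (f 2) (f 2 ^ k) ⟩
    (g * (o ^ suc k * f 2)) * f 2 ^ k      ≈⟨ *-congʳ {f 2 ^ k} (*-congˡ {g} (factors-partTypes (suc k) M)) ⟨
    (g * factors (map double ts)) * f 2 ^ k
      ≈⟨ *-congʳ {f 2 ^ k} (count-factors (map double ts) (All.map⁺ (All.map (λ {t} 1≤t → ℕ.≤-trans 1≤t (ℕ.m≤m+n t t)) (partTypes-positive (suc k) (double M))))) ⟩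
    1# * f 2 ^ k                           ≈⟨ *-identityˡ (f 2 ^ k) ⟩
    f 2 ^ k                                ∎
    where
    g = gf (suc k)
    o = P (x * x) (- x) M
    ts = partTypes (suc k) (double M)

  gf-avoid : ∀ {r} k l → k ℕ.+ l ≡ 6 → Avoid r (f 2 ^ k * f 1 ^ l) → Avoid r (gf (suc k))
  gf-avoid k l k+l≡6 avoid = u-cancel 1 (Supp-≈ (sym product) avoid)
    where
    g = gf (suc k)
    product : g * u 1 ≈ f 2 ^ k * f 1 ^ l
    product = begin
      g * f 1 ^ 7                      ≡⟨ ≡.cong (λ m → g * f 1 ^ suc m) k+l≡6 ⟨
      g * f 1 ^ (suc k ℕ.+ l)          ≈⟨ *-congˡ {g} (^-homo-* (f 1) (suc k) l) ⟩
      g * (f 1 ^ suc k * f 1 ^ l)      ≈⟨ *-assoc g (f 1 ^ suc k) (f 1 ^ l) ⟨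
      (g * f 1 ^ suc k) * f 1 ^ l      ≈⟨ *-congʳ {f 1 ^ l} (gf-product k) ⟩
      f 2 ^ k * f 1 ^ l                ∎

  divides-a : ∀ {r} k → double n ≡₇ r → Avoid r (gf k) → 7 ∣ a k n
  divides-a k 2n≡r avoid = [ (λ ¬r → ⊥-elim (¬r 2n≡r)) , (λ { (mod₇ e) → ≡.subst (7 ∣_) (gf-coefficient k) (m%n≡0⇒n∣m (gf k (double n)) 7 e) }) ]′
    -- The truncation is at N₀ = 2n + 1, so 2n is the last exponent covered.
    (Supp.at avoid (double n) ℕ.≤-refl)

  claims₁ : Claims 1
  claims₁ = claims M 0 (ℕ.m≤m+n M 1)

  -- The classes are doubled together with the part sizes: 10 = 2 · 5, and below 4 = 2 · 2, 8 = 2 ·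
  -- 4, 12 = 2 · 6. For k = 7 the cubes sit at level 2, which gives 20 = 4 · 5 ≡ 2 · 3.
  a₁-divisible : double n ≡₇ 10 → 7 ∣ a 1 n
  a₁-divisible 2n≡ = divides-a 1 2n≡ (gf-avoid 0 6 ≡.refl
    (Supp-≈ (solve 1 (λ a → a :^ 3 :* a :^ 3 := con 1 :* a :^ 6) refl (f 1)) (cubes-avoid-1-1 1)))

  a₃-divisible : double n ≡₇ 4 → 7 ∣ a 3 n
  a₃-divisible 2n≡ = divides-a 3 2n≡ (gf-avoid 2 4 ≡.refl (Supp-≈ (*-comm (f 1 ^ 4) (f 2 ^ 2)) (Claims.E-avoid claims₁)))

  a₄-divisible : double n ≡₇ 8 → 7 ∣ a 4 n
  a₄-divisible 2n≡ = divides-a 4 2n≡ (gf-avoid 3 3 ≡.refl (Supp-≈ (*-comm (f 1 ^ 3) (f 2 ^ 3)) (cubes-avoid-1-2 1)))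

  a₅-divisible : double n ≡₇ 12 → 7 ∣ a 5 n
  a₅-divisible 2n≡ = divides-a 5 2n≡ (gf-avoid 4 2 ≡.refl
    (Supp-≈ (trans (φ-neg-f 1) (*-comm (f 1 ^ 2) (f 2 ^ 4))) (Claims.G-avoid claims₁ neg)))

  a₇-divisible : double n ≡₇ 20 → 7 ∣ a 7 n
  a₇-divisible 2n≡ = divides-a 7 2n≡ (gf-avoid 6 0 ≡.refl
    (Supp-≈ (solve 1 (λ a → a :^ 3 :* a :^ 3 := a :^ 6 :* con 1) refl (f 2)) (cubes-avoid-1-1 2)))

double-residue : ∀ n r s c → r ℕ.+ r ≡ s ℕ.+ c ℕ.* 7 → double (7 ℕ.* n ℕ.+ r) ≡₇ s
double-residue n r s c eq = ≡₇-drop s (2 ℕ.* n ℕ.+ c) (begin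
  double (7 ℕ.* n ℕ.+ r)                ≡⟨ solve 2 (λ n r → (con 7 :* n :+ r) :+ (con 7 :* n :+ r) := (con 2 :* n) :* con 7 :+ (r :+ r)) ≡.refl n r ⟩
  (2 ℕ.* n) ℕ.* 7 ℕ.+ (r ℕ.+ r)         ≡⟨ ≡.cong ((2 ℕ.* n) ℕ.* 7 ℕ.+_) eq ⟩
  (2 ℕ.* n) ℕ.* 7 ℕ.+ (s ℕ.+ c ℕ.* 7)   ≡⟨ solve 3 (λ m s c → m :* con 7 :+ (s :+ c :* con 7) := s :+ (m :+ c) :* con 7) ≡.refl (2 ℕ.* n) s c ⟩
  s ℕ.+ (2 ℕ.* n ℕ.+ c) ℕ.* 7           ∎)
  where
  open ≡.≡-Reasoning
  open +-*-Solver

open import Data.Nat using (_+_; _*_)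

theorem3 : (n : ℕ) →
    (7 ∣ a 1 (7 * n + 5)) × (7 ∣ a 3 (7 * n + 2)) × (7 ∣ a 4 (7 * n + 4))
    × (7 ∣ a 5 (7 * n + 6)) × (7 ∣ a 7 (7 * n + 3))
theorem3 n
  = GeneratingFunction.a₁-divisible (7 * n + 5) (double-residue n 5 10 0 ≡.refl)
  , GeneratingFunction.a₃-divisible (7 * n + 2) (double-residue n 2 4 0 ≡.refl)
  , GeneratingFunction.a₄-divisible (7 * n + 4) (double-residue n 4 8 0 ≡.refl)
  , GeneratingFunction.a₅-divisible (7 * n + 6) (double-residue n 6 12 0 ≡.refl)
  , GeneratingFunction.a₇-divisible (7 * n + 3) (≡₇-trans (double-residue n 3 6 0 ≡.refl) (mod₇ ≡.refl))
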